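{- Let $k$ be the number of arms and $T$ the time horizon. For any randomized algorithm for the improving multi-armed bandits problem, there exists an instance with $k$ arms and horizon $T$ on which its approximation factor is at least $\sqrt{k}/3$; that is, an instance with $OPT_T>0$ for which the expected reward $ALG_T$ of the algorithm satisfies $ALG_T\le \dfrac{3\,OPT_T}{\sqrt{k}}$.
   Context: An instance of the improving multi-armed bandits problem consists of $k$ arms; arm $i$ has a reward function $f_i:\{0,1,2,\dots\}\to\mathbb{R}_{\ge 0}$ that is nondecreasing, satisfies $f_i(0)=0$, and has diminishing returns: $f_i(t+1)-f_i(t)\le f_i(t)-f_i(t-1)$ for all $t\ge 1$. Pulling arm $i$ for the $t$-th time yields reward $f_i(t)$ (the argument is the number of times that arm has been pulled, not the global time). An algorithm pulls one arm per step for $T$ steps; it does not know the $f_i$ in advance and only observes the rewards of its own pulls. Its reward is the sum of the $T$ rewards obtained; for a randomized algorithm, $ALG_T$ is the expectation over its internal randomness, the instance being fixed (oblivious adversary). The optimal reward is $OPT_T=\max_i\sum_{t=1}^T f_i(t)$. The approximation factor on an instance is $OPT_T/ALG_T$. -}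

module Defs where

open import Data.Fin using (Fin; zero; suc; toℕ; _≟_)
import Data.Integer as ℤ
import Data.Integer.Properties as ℤₚ
import Data.Integer.Solver as ℤ-Solver
open import Data.List using (List; []; _∷_; length; filter; map; foldr)
open import Data.Nat as ℕ using (ℕ; zero; suc; NonZero)
import Data.Nat.Properties as ℕₚ
import Data.Nat.Solver as ℕ-Solver
open import Data.Product using (∃-syntax; _×_; _,_; proj₁; proj₂)
open import Data.Rational as ℚ using (ℚ; 0ℚ; 1ℚ; ½; ∣_∣)
import Data.Rational.Properties as ℚₚ
import Data.Rational.Solver as ℚ-Solver
import Data.Rational.Unnormalised as ℚᵘ
import Data.Rational.Unnormalised.Properties as ℚᵘₚ
open import Data.Sum using (inj₁; inj₂)
import Data.Vec.Functional as Vector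
open import Relation.Binary.PropositionalEquality
  using (_≡_; refl; sym; trans; cong; cong₂; subst; subst₂; module ≡-Reasoning)
open import Relation.Nullary using (yes; no; contradiction)

private
  module Q = ℚ-Solver.+-*-Solver
  module N = ℕ-Solver.+-*-Solver
  module Z = ℤ-Solver.+-*-Solver

  p≤∣p∣ : ∀ p → p ℚ.≤ ∣ p ∣
  p≤∣p∣ p with ℚₚ.≤-total 0ℚ p
  ... | inj₁ 0≤p = ℚₚ.≤-reflexive (sym (ℚₚ.0≤p⇒∣p∣≡p 0≤p))
  ... | inj₂ p≤0 = ℚₚ.≤-trans p≤0 (ℚₚ.0≤∣p∣ p)

  ∣-∣-swap : ∀ p q → ∣ p ℚ.- q ∣ ≡ ∣ q ℚ.- p ∣
  ∣-∣-swap p q = trans (sym (ℚₚ.∣-p∣≡∣p∣ (p ℚ.- q)))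
    (cong ∣_∣ (Q.solve 2 (λ p q → Q.:- (p Q.:- q) Q.:= q Q.:- p) refl p q))

  ∣p-q∣≤⇒p≤q+ : ∀ p q {ε} → ∣ p ℚ.- q ∣ ℚ.≤ ε → p ℚ.≤ q ℚ.+ ε
  ∣p-q∣≤⇒p≤q+ p q {ε} h = begin
    p                    ≡⟨ Q.solve 2 (λ p q → p Q.:= q Q.:+ (p Q.:- q)) refl p q ⟩
    q ℚ.+ (p ℚ.- q)      ≤⟨ ℚₚ.+-monoʳ-≤ q (ℚₚ.≤-trans (p≤∣p∣ (p ℚ.- q)) h) ⟩
    q ℚ.+ ε              ∎
    where open ℚₚ.≤-Reasoning

  p≤q+⇒p-q≤ : ∀ p q {ε} → p ℚ.≤ q ℚ.+ ε → p ℚ.- q ℚ.≤ ε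
  p≤q+⇒p-q≤ p q {ε} h = begin
    p ℚ.- q            ≤⟨ ℚₚ.+-monoˡ-≤ (ℚ.- q) h ⟩
    (q ℚ.+ ε) ℚ.- q    ≡⟨ Q.solve 2 (λ q ε → (q Q.:+ ε) Q.:- q Q.:= ε) refl q ε ⟩
    ε                  ∎
    where open ℚₚ.≤-Reasoning

  within : ∀ p q {ε} → p ℚ.≤ q ℚ.+ ε → q ℚ.≤ p ℚ.+ ε → ∣ p ℚ.- q ∣ ℚ.≤ ε
  within p q {ε} h₁ h₂ with ℚₚ.∣p∣≡p∨∣p∣≡-p (p ℚ.- q)
  ... | inj₁ e = subst (ℚ._≤ ε) (sym e) (p≤q+⇒p-q≤ p q h₁)
  ... | inj₂ e = subst (ℚ._≤ ε)
    (sym (trans e (Q.solve 2 (λ p q → Q.:- (p Q.:- q) Q.:= q Q.:- p) refl p q)))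
    (p≤q+⇒p-q≤ q p h₂)

  0<* : ∀ {p q} → 0ℚ ℚ.< p → 0ℚ ℚ.< q → 0ℚ ℚ.< p ℚ.* q
  0<* {p} {q} 0<p 0<q = ℚₚ.positive⁻¹ (p ℚ.* q)
    where instance
      _ = ℚ.positive 0<p
      _ = ℚ.positive 0<q
      _ = ℚₚ.pos*pos⇒pos p q

  ½+½ : ∀ ε → ½ ℚ.* ε ℚ.+ ½ ℚ.* ε ≡ ε
  ½+½ ε = trans (sym (ℚₚ.*-distribʳ-+ ε ½ ½)) (ℚₚ.*-identityˡ ε)

  0<½ε : ∀ {ε} → 0ℚ ℚ.< ε → 0ℚ ℚ.< ½ ℚ.* ε
  0<½ε = 0<* (ℚₚ.positive⁻¹ ½)

  *-mono : ∀ {p q r s} → 0ℚ ℚ.≤ q → 0ℚ ℚ.≤ r →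
           p ℚ.≤ q → r ℚ.≤ s → p ℚ.* r ℚ.≤ q ℚ.* s
  *-mono {p} {q} {r} {s} 0≤q 0≤r p≤q r≤s = ℚₚ.≤-trans
    (ℚₚ.*-monoʳ-≤-nonNeg r {{ℚ.nonNegative 0≤r}} p≤q)
    (ℚₚ.*-monoˡ-≤-nonNeg q {{ℚ.nonNegative 0≤q}} r≤s)

  ⊔-within : ∀ p q r s {ε} → ∣ p ℚ.- q ∣ ℚ.≤ ε → ∣ r ℚ.- s ∣ ℚ.≤ ε →
             ∣ (p ℚ.⊔ r) ℚ.- (q ℚ.⊔ s) ∣ ℚ.≤ ε
  ⊔-within p q r s {ε} h₁ h₂ = within (p ℚ.⊔ r) (q ℚ.⊔ s) (side p q r s h₁ h₂)
    (side q p s r (subst (ℚ._≤ ε) (∣-∣-swap p q) h₁) (subst (ℚ._≤ ε) (∣-∣-swap r s) h₂))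
    where
    side : ∀ p q r s → ∣ p ℚ.- q ∣ ℚ.≤ ε → ∣ r ℚ.- s ∣ ℚ.≤ ε →
           p ℚ.⊔ r ℚ.≤ (q ℚ.⊔ s) ℚ.+ ε
    side p q r s h₁ h₂ = ℚₚ.⊔-lub
      (ℚₚ.≤-trans (∣p-q∣≤⇒p≤q+ p q h₁) (ℚₚ.+-monoˡ-≤ ε {q} {q ℚ.⊔ s} (ℚₚ.p≤p⊔q q s)))
      (ℚₚ.≤-trans (∣p-q∣≤⇒p≤q+ r s h₂) (ℚₚ.+-monoˡ-≤ ε {s} {q ℚ.⊔ s} (ℚₚ.p≤q⊔p q s)))

  0≤⇒<1+ : ∀ {p} → 0ℚ ℚ.≤ p → 0ℚ ℚ.< p ℚ.+ 1ℚ
  0≤⇒<1+ {p} 0≤p = ℚₚ.<-≤-trans (ℚₚ.positive⁻¹ 1ℚ)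
    (ℚₚ.≤-trans (ℚₚ.≤-reflexive (sym (ℚₚ.+-identityˡ 1ℚ))) (ℚₚ.+-monoˡ-≤ 1ℚ 0≤p))

  /-≤ : ∀ a b c d → a ℕ.* suc d ℕ.≤ c ℕ.* suc b →
        (ℤ.+ a ℚ./ suc b) ℚ.≤ (ℤ.+ c ℚ./ suc d)
  /-≤ a b c d h = ℚₚ.toℚᵘ-cancel-≤
    (ℚᵘₚ.≤-respˡ-≃ (ℚᵘₚ.≃-sym (ℚₚ.toℚᵘ-fromℚᵘ (ℚᵘ.mkℚᵘ (ℤ.+ a) b)))
    (ℚᵘₚ.≤-respʳ-≃ (ℚᵘₚ.≃-sym (ℚₚ.toℚᵘ-fromℚᵘ (ℚᵘ.mkℚᵘ (ℤ.+ c) d)))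
      (ℚᵘ.*≤* (subst₂ ℤ._≤_ (ℤₚ.pos-* a (suc d)) (ℤₚ.pos-* c (suc b)) (ℤ.+≤+ h)))))

  1/n≤ : ∀ ε → 0ℚ ℚ.< ε → ∃[ N ] ∀ n → N ℕ.≤ n → (ℤ.+ 1 ℚ./ suc n) ℚ.≤ ε
  1/n≤ ε@(ℚ.mkℚ (ℤ.+ zero) b _) 0<ε with () ← ℚ.positive 0<ε
  1/n≤ ε@(ℚ.mkℚ ℤ.-[1+ _ ] b _) 0<ε with () ← ℚ.positive 0<ε
  1/n≤ ε@(ℚ.mkℚ (ℤ.+ suc a) b _) _ = b , λ n b≤n →
    subst ((ℤ.+ 1 ℚ./ suc n) ℚ.≤_) (ℚₚ.↥p/↧p≡p ε)
      (/-≤ 1 n (suc a) b (ℕₚ.*-mono-≤ {1} {suc a} (ℕ.s≤s ℕ.z≤n) (ℕ.s≤s b≤n)))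

  suc/ : ∀ r n → (ℤ.+ suc r ℚ./ suc n) ≡ (ℤ.+ r ℚ./ suc n) ℚ.+ (ℤ.+ 1 ℚ./ suc n)
  suc/ r n = ℚₚ.toℚᵘ-injective (begin
    ℚ.toℚᵘ (ℤ.+ suc r ℚ./ suc n)
      ≈⟨ ℚₚ.toℚᵘ-fromℚᵘ (ℚᵘ.mkℚᵘ (ℤ.+ suc r) n) ⟩
    ℚᵘ.mkℚᵘ (ℤ.+ suc r) n
      ≈⟨ ℚᵘ.*≡* (Z.solve 2 (λ r N → (Z.con (ℤ.+ 1) Z.:+ r) Z.:* (N Z.:* N) Z.:=
           (r Z.:* N Z.:+ Z.con (ℤ.+ 1) Z.:* N) Z.:* N) refl (ℤ.+ r) (ℤ.+ suc n)) ⟩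
    ℚᵘ.mkℚᵘ (ℤ.+ r) n ℚᵘ.+ ℚᵘ.mkℚᵘ (ℤ.+ 1) n
      ≈⟨ ℚᵘₚ.+-cong (ℚₚ.toℚᵘ-fromℚᵘ (ℚᵘ.mkℚᵘ (ℤ.+ r) n))
                    (ℚₚ.toℚᵘ-fromℚᵘ (ℚᵘ.mkℚᵘ (ℤ.+ 1) n)) ⟨
    ℚ.toℚᵘ (ℤ.+ r ℚ./ suc n) ℚᵘ.+ ℚ.toℚᵘ (ℤ.+ 1 ℚ./ suc n)
      ≈⟨ ℚₚ.toℚᵘ-homo-+ (ℤ.+ r ℚ./ suc n) (ℤ.+ 1 ℚ./ suc n) ⟨
    ℚ.toℚᵘ ((ℤ.+ r ℚ./ suc n) ℚ.+ (ℤ.+ 1 ℚ./ suc n)) ∎)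
    where open import Relation.Binary.Reasoning.Setoid ℚᵘₚ.≃-setoid

  ²-cancel-< : ∀ {a b} → a ℕ.* a ℕ.< b ℕ.* b → a ℕ.< b
  ²-cancel-< {a} {b} a²<b² with b ℕ.≤? a
  ... | yes b≤a = contradiction (ℕₚ.*-mono-≤ b≤a b≤a) (ℕₚ.<⇒≱ a²<b²)
  ... | no  b≰a = ℕₚ.≰⇒> b≰a

-- isqrt n is ⌊√n⌋.
isqrt : ℕ → ℕ
isqrt zero    = zero
isqrt (suc n) = next (isqrt n)
  module Isqrt where
  next : ℕ → ℕ
  next r with suc r ℕ.* suc r ℕ.≤? suc n
  ... | yes _ = suc r
  ... | no  _ = r

isqrt²≤ : ∀ n → isqrt n ℕ.* isqrt n ℕ.≤ n
isqrt²≤ zero = ℕ.z≤n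
isqrt²≤ (suc n) with suc (isqrt n) ℕ.* suc (isqrt n) ℕ.≤? suc n
... | yes p = p
... | no  _ = ℕₚ.m≤n⇒m≤1+n (isqrt²≤ n)

<[1+isqrt]² : ∀ n → n ℕ.< suc (isqrt n) ℕ.* suc (isqrt n)
<[1+isqrt]² zero = ℕ.s≤s ℕ.z≤n
<[1+isqrt]² (suc n) with suc (isqrt n) ℕ.* suc (isqrt n) ℕ.≤? suc n
... | yes _ = ℕₚ.≤-<-trans (<[1+isqrt]² n)
                (ℕₚ.*-mono-< {suc r} {suc (suc r)} {suc r} (ℕₚ.n<1+n (suc r)) (ℕₚ.n<1+n (suc r)))
  where r = isqrt n
... | no  p = ℕₚ.≰⇒> p

-- Reals are Cauchy sequences of rationals; equality of reals is _≈_, not _≡_.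
Cauchy : (ℕ → ℚ) → Set
Cauchy x = ∀ ε → 0ℚ ℚ.< ε →
  ∃[ N ] ∀ m n → N ℕ.≤ m → N ℕ.≤ n → ∣ x m ℚ.- x n ∣ ℚ.≤ ε

record ℝ : Set where
  no-eta-equality
  field
    seq    : ℕ → ℚ
    cauchy : Cauchy seq

open ℝ public

infix 4 _≈_ _≤_ _<_

record _≈_ (x y : ℝ) : Set where
  constructor mk≈
  field
    close : ∀ ε → 0ℚ ℚ.< ε →
      ∃[ N ] ∀ n → N ℕ.≤ n → ∣ seq x n ℚ.- seq y n ∣ ℚ.≤ ε

record _≤_ (x y : ℝ) : Set where
  constructor mk≤
  field
    below : ∀ ε → 0ℚ ℚ.< ε →
      ∃[ N ] ∀ n → N ℕ.≤ n → seq x n ℚ.≤ seq y n ℚ.+ ε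

record _<_ (x y : ℝ) : Set where
  constructor mk<
  field
    gap   : ℚ
    gap>0 : 0ℚ ℚ.< gap
    from  : ℕ
    apart : ∀ n → from ℕ.≤ n → seq x n ℚ.+ gap ℚ.≤ seq y n

private
  eventuallyBounded : (x : ℝ) → ∃[ B ] (0ℚ ℚ.< B) × ∃[ N ] ∀ n → N ℕ.≤ n →
                      ∣ seq x n ∣ ℚ.≤ B
  eventuallyBounded x = ∣ seq x N ∣ ℚ.+ 1ℚ , 0≤⇒<1+ (ℚₚ.0≤∣p∣ (seq x N)) , N ,
    λ n N≤n → begin
      ∣ seq x n ∣
        ≡⟨ cong ∣_∣ (Q.solve 2 (λ p q → p Q.:= q Q.:+ (p Q.:- q)) refl (seq x n) (seq x N)) ⟩
      ∣ seq x N ℚ.+ (seq x n ℚ.- seq x N) ∣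
        ≤⟨ ℚₚ.∣p+q∣≤∣p∣+∣q∣ (seq x N) (seq x n ℚ.- seq x N) ⟩
      ∣ seq x N ∣ ℚ.+ ∣ seq x n ℚ.- seq x N ∣
        ≤⟨ ℚₚ.+-monoʳ-≤ ∣ seq x N ∣ (proj₂ (cauchy x 1ℚ (ℚₚ.positive⁻¹ 1ℚ)) n N N≤n ℕₚ.≤-refl) ⟩
      ∣ seq x N ∣ ℚ.+ 1ℚ ∎
    where
    open ℚₚ.≤-Reasoning
    N = proj₁ (cauchy x 1ℚ (ℚₚ.positive⁻¹ 1ℚ))

infixl 6 _+_ _-_ _⊔_
infixl 7 _*_ _/_
infix  8 √_ _⁻¹

fromℕ : ℕ → ℝ
fromℕ k .seq _ = ℤ.+ k ℚ./ 1
fromℕ k .cauchy ε 0<ε = 0 , λ _ _ _ _ →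
  subst (λ p → ∣ p ∣ ℚ.≤ ε) (sym (ℚₚ.+-inverseʳ (ℤ.+ k ℚ./ 1))) (ℚₚ.<⇒≤ 0<ε)

0ℝ 1ℝ : ℝ
0ℝ = fromℕ 0
1ℝ = fromℕ 1

_+_ : ℝ → ℝ → ℝ
(x + y) .seq n = seq x n ℚ.+ seq y n
(x + y) .cauchy ε 0<ε with cauchy x (½ ℚ.* ε) (0<½ε 0<ε) | cauchy y (½ ℚ.* ε) (0<½ε 0<ε)
... | M , p | N , q = M ℕ.⊔ N , λ m n m≥ n≥ →
  let a = seq x m ; b = seq y m ; c = seq x n ; d = seq y n in begin
    ∣ (a ℚ.+ b) ℚ.- (c ℚ.+ d) ∣
      ≡⟨ cong ∣_∣ (Q.solve 4 (λ a b c d →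
           (a Q.:+ b) Q.:- (c Q.:+ d) Q.:= (a Q.:- c) Q.:+ (b Q.:- d)) refl a b c d) ⟩
    ∣ (a ℚ.- c) ℚ.+ (b ℚ.- d) ∣
      ≤⟨ ℚₚ.∣p+q∣≤∣p∣+∣q∣ (a ℚ.- c) (b ℚ.- d) ⟩
    ∣ a ℚ.- c ∣ ℚ.+ ∣ b ℚ.- d ∣
      ≤⟨ ℚₚ.+-mono-≤ (p m n (ℕₚ.m⊔n≤o⇒m≤o M N m≥) (ℕₚ.m⊔n≤o⇒m≤o M N n≥))
                     (q m n (ℕₚ.m⊔n≤o⇒n≤o M N m≥) (ℕₚ.m⊔n≤o⇒n≤o M N n≥)) ⟩
    ½ ℚ.* ε ℚ.+ ½ ℚ.* ε
      ≡⟨ ½+½ ε ⟩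
    ε ∎
  where open ℚₚ.≤-Reasoning

-_ : ℝ → ℝ
(- x) .seq n = ℚ.- seq x n
(- x) .cauchy ε 0<ε with cauchy x ε 0<ε
... | N , p = N , λ m n m≥ n≥ → subst (ℚ._≤ ε)
  (trans (∣-∣-swap (seq x m) (seq x n)) (cong ∣_∣
    (Q.solve 2 (λ a c → c Q.:- a Q.:= (Q.:- a) Q.:- (Q.:- c)) refl (seq x m) (seq x n))))
  (p m n m≥ n≥)

_-_ : ℝ → ℝ → ℝ
x - y = x + (- y)

private
  product-within : ∀ {A B δ} → 0ℚ ℚ.≤ A → 0ℚ ℚ.≤ δ → ∀ a b c d →
    ∣ a ∣ ℚ.≤ A → ∣ d ∣ ℚ.≤ B → ∣ a ℚ.- c ∣ ℚ.≤ δ → ∣ b ℚ.- d ∣ ℚ.≤ δ →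
    ∣ a ℚ.* b ℚ.- c ℚ.* d ∣ ℚ.≤ A ℚ.* δ ℚ.+ δ ℚ.* B
  product-within {A} {B} {δ} 0≤A 0≤δ a b c d ∣a∣≤A ∣d∣≤B p q = begin
    ∣ a ℚ.* b ℚ.- c ℚ.* d ∣
      ≡⟨ cong ∣_∣ (Q.solve 4 (λ a b c d → a Q.:* b Q.:- c Q.:* d Q.:=
           a Q.:* (b Q.:- d) Q.:+ (a Q.:- c) Q.:* d) refl a b c d) ⟩
    ∣ a ℚ.* (b ℚ.- d) ℚ.+ (a ℚ.- c) ℚ.* d ∣
      ≤⟨ ℚₚ.∣p+q∣≤∣p∣+∣q∣ (a ℚ.* (b ℚ.- d)) ((a ℚ.- c) ℚ.* d) ⟩
    ∣ a ℚ.* (b ℚ.- d) ∣ ℚ.+ ∣ (a ℚ.- c) ℚ.* d ∣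
      ≡⟨ cong₂ ℚ._+_ (ℚₚ.∣p*q∣≡∣p∣*∣q∣ a (b ℚ.- d)) (ℚₚ.∣p*q∣≡∣p∣*∣q∣ (a ℚ.- c) d) ⟩
    ∣ a ∣ ℚ.* ∣ b ℚ.- d ∣ ℚ.+ ∣ a ℚ.- c ∣ ℚ.* ∣ d ∣
      ≤⟨ ℚₚ.+-mono-≤ (*-mono 0≤A (ℚₚ.0≤∣p∣ (b ℚ.- d)) ∣a∣≤A q)
                     (*-mono 0≤δ (ℚₚ.0≤∣p∣ d) p ∣d∣≤B) ⟩
    A ℚ.* δ ℚ.+ δ ℚ.* B ∎
    where open ℚₚ.≤-Reasoning

  share : ∀ {A B ε} → 0ℚ ℚ.< A → 0ℚ ℚ.< B → 0ℚ ℚ.< ε →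
          ∃[ δ ] (0ℚ ℚ.< δ) × (A ℚ.* δ ℚ.+ δ ℚ.* B ≡ ε)
  share {A} {B} {ε} 0<A 0<B 0<ε = ε ℚ.* i ,
    0<* 0<ε (ℚₚ.positive⁻¹ i {{ℚₚ.1/pos⇒pos (A ℚ.+ B)}}) , (begin
    A ℚ.* (ε ℚ.* i) ℚ.+ (ε ℚ.* i) ℚ.* B
      ≡⟨ Q.solve 4 (λ A B ε i → A Q.:* (ε Q.:* i) Q.:+ (ε Q.:* i) Q.:* B Q.:=
           ε Q.:* ((A Q.:+ B) Q.:* i)) refl A B ε i ⟩
    ε ℚ.* ((A ℚ.+ B) ℚ.* i)
      ≡⟨ cong (ε ℚ.*_) (ℚₚ.*-inverseʳ (A ℚ.+ B)) ⟩
    ε ℚ.* 1ℚ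
      ≡⟨ ℚₚ.*-identityʳ ε ⟩
    ε ∎)
    where
    open ≡-Reasoning
    instance
      A+B>0 = ℚ.positive (ℚₚ.+-mono-< 0<A 0<B)
      A+B≢0 = ℚₚ.pos⇒nonZero (A ℚ.+ B)
    i = ℚ.1/ (A ℚ.+ B)

_*_ : ℝ → ℝ → ℝ
(x * y) .seq n = seq x n ℚ.* seq y n
(x * y) .cauchy ε 0<ε =
  let A , 0<A , K , boundA = eventuallyBounded x
      B , 0<B , L , boundB = eventuallyBounded y
      δ , 0<δ , shares     = share 0<A 0<B 0<ε
      M , p                = cauchy x δ 0<δ
      N , q                = cauchy y δ 0<δ
      fromK = λ n (n≥ : (K ℕ.⊔ L) ℕ.⊔ (M ℕ.⊔ N) ℕ.≤ n) →
                ℕₚ.m⊔n≤o⇒m≤o K L (ℕₚ.m⊔n≤o⇒m≤o (K ℕ.⊔ L) (M ℕ.⊔ N) n≥)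
      fromL = λ n (n≥ : (K ℕ.⊔ L) ℕ.⊔ (M ℕ.⊔ N) ℕ.≤ n) →
                ℕₚ.m⊔n≤o⇒n≤o K L (ℕₚ.m⊔n≤o⇒m≤o (K ℕ.⊔ L) (M ℕ.⊔ N) n≥)
      fromM = λ n (n≥ : (K ℕ.⊔ L) ℕ.⊔ (M ℕ.⊔ N) ℕ.≤ n) →
                ℕₚ.m⊔n≤o⇒m≤o M N (ℕₚ.m⊔n≤o⇒n≤o (K ℕ.⊔ L) (M ℕ.⊔ N) n≥)
      fromN = λ n (n≥ : (K ℕ.⊔ L) ℕ.⊔ (M ℕ.⊔ N) ℕ.≤ n) →
                ℕₚ.m⊔n≤o⇒n≤o M N (ℕₚ.m⊔n≤o⇒n≤o (K ℕ.⊔ L) (M ℕ.⊔ N) n≥)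
  in (K ℕ.⊔ L) ℕ.⊔ (M ℕ.⊔ N) , λ m n m≥ n≥ →
    subst (∣ seq x m ℚ.* seq y m ℚ.- seq x n ℚ.* seq y n ∣ ℚ.≤_) shares
      (product-within (ℚₚ.<⇒≤ 0<A) (ℚₚ.<⇒≤ 0<δ) (seq x m) (seq y m) (seq x n) (seq y n)
        (boundA m (fromK m m≥)) (boundB n (fromL n n≥))
        (p m n (fromM m m≥) (fromM n n≥)) (q m n (fromN m m≥) (fromN n n≥)))

_⊔_ : ℝ → ℝ → ℝ
(x ⊔ y) .seq n = seq x n ℚ.⊔ seq y n
(x ⊔ y) .cauchy ε 0<ε with cauchy x ε 0<ε | cauchy y ε 0<ε
... | M , p | N , q = M ℕ.⊔ N , λ m n m≥ n≥ → ⊔-within (seq x m) (seq x n) (seq y m) (seq y n)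
  (p m n (ℕₚ.m⊔n≤o⇒m≤o M N m≥) (ℕₚ.m⊔n≤o⇒m≤o M N n≥))
  (q m n (ℕₚ.m⊔n≤o⇒n≤o M N m≥) (ℕₚ.m⊔n≤o⇒n≤o M N n≥))

private
  inverse-within : ∀ u v {δ ε} → .{{_ : ℚ.NonZero u}} → .{{_ : ℚ.NonZero v}} →
    0ℚ ℚ.< δ → δ ℚ.≤ u → δ ℚ.≤ v →
    ∣ u ℚ.- v ∣ ℚ.≤ ε ℚ.* (δ ℚ.* δ) → ∣ ℚ.1/ u ℚ.- ℚ.1/ v ∣ ℚ.≤ ε
  inverse-within u v {δ} {ε} 0<δ δ≤u δ≤v h =
    ℚₚ.*-cancelʳ-≤-pos (δ ℚ.* δ) {{ℚ.positive (0<* 0<δ 0<δ)}} (begin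
    ∣ i ℚ.- j ∣ ℚ.* (δ ℚ.* δ)
      ≤⟨ ℚₚ.*-monoˡ-≤-nonNeg ∣ i ℚ.- j ∣ {{ℚₚ.∣-∣-nonNeg (i ℚ.- j)}}
           (*-mono (ℚₚ.<⇒≤ 0<u) (ℚₚ.<⇒≤ 0<δ) δ≤u δ≤v) ⟩
    ∣ i ℚ.- j ∣ ℚ.* (u ℚ.* v)
      ≡⟨ cong (∣ i ℚ.- j ∣ ℚ.*_) (ℚₚ.0≤p⇒∣p∣≡p (ℚₚ.<⇒≤ (0<* 0<u 0<v))) ⟨
    ∣ i ℚ.- j ∣ ℚ.* ∣ u ℚ.* v ∣
      ≡⟨ ℚₚ.∣p*q∣≡∣p∣*∣q∣ (i ℚ.- j) (u ℚ.* v) ⟨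
    ∣ (i ℚ.- j) ℚ.* (u ℚ.* v) ∣
      ≡⟨ cong ∣_∣ (Q.solve 4 (λ u v i j → (i Q.:- j) Q.:* (u Q.:* v) Q.:=
           (i Q.:* u) Q.:* v Q.:- (j Q.:* v) Q.:* u) refl u v i j) ⟩
    ∣ (i ℚ.* u) ℚ.* v ℚ.- (j ℚ.* v) ℚ.* u ∣
      ≡⟨ cong₂ (λ p q → ∣ p ℚ.* v ℚ.- q ℚ.* u ∣) (ℚₚ.*-inverseˡ u) (ℚₚ.*-inverseˡ v) ⟩
    ∣ 1ℚ ℚ.* v ℚ.- 1ℚ ℚ.* u ∣
      ≡⟨ cong₂ (λ p q → ∣ p ℚ.- q ∣) (ℚₚ.*-identityˡ v) (ℚₚ.*-identityˡ u) ⟩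
    ∣ v ℚ.- u ∣
      ≡⟨ ∣-∣-swap v u ⟩
    ∣ u ℚ.- v ∣
      ≤⟨ h ⟩
    ε ℚ.* (δ ℚ.* δ) ∎)
    where
    open ℚₚ.≤-Reasoning
    i = ℚ.1/ u
    j = ℚ.1/ v
    0<u = ℚₚ.<-≤-trans 0<δ δ≤u
    0<v = ℚₚ.<-≤-trans 0<δ δ≤v

  max-nonZero : ∀ {δ} → 0ℚ ℚ.< δ → ∀ p → ℚ.NonZero (p ℚ.⊔ δ)
  max-nonZero {δ} 0<δ p = ℚ.>-nonZero (ℚₚ.<-≤-trans 0<δ (ℚₚ.p≤q⊔p p δ))

-- The terms of x are eventually at least δ, so taking the maximum with δ > 0
-- changes only finitely many of them, and makes all of them invertible.
_⁻¹ : (x : ℝ) → {{0ℝ < x}} → ℝ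
_⁻¹ x {{mk< δ 0<δ _ _}} .seq n =
  ℚ.1/_ (seq x n ℚ.⊔ δ) {{max-nonZero 0<δ (seq x n)}}
_⁻¹ x {{mk< δ 0<δ _ _}} .cauchy ε 0<ε =
  let N , p = cauchy x (ε ℚ.* (δ ℚ.* δ)) (0<* 0<ε (0<* 0<δ 0<δ))
  in N , λ m n m≥ n≥ →
    inverse-within (seq x m ℚ.⊔ δ) (seq x n ℚ.⊔ δ)
      {{max-nonZero 0<δ (seq x m)}} {{max-nonZero 0<δ (seq x n)}}
      0<δ (ℚₚ.p≤q⊔p (seq x m) δ) (ℚₚ.p≤q⊔p (seq x n) δ)
      (⊔-within (seq x m) (seq x n) δ δ (p m n m≥ n≥)
        (subst (λ p → ∣ p ∣ ℚ.≤ ε ℚ.* (δ ℚ.* δ)) (sym (ℚₚ.+-inverseʳ δ))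
          (ℚₚ.<⇒≤ (0<* 0<ε (0<* 0<δ 0<δ)))))

_/_ : (x y : ℝ) → {{0ℝ < y}} → ℝ
x / y = x * y ⁻¹

private
  √-upper : ∀ k m n →
    isqrt (k ℕ.* (suc m ℕ.* suc m)) ℕ.* suc n ℕ.≤
    suc (isqrt (k ℕ.* (suc n ℕ.* suc n))) ℕ.* suc m
  √-upper k m n = ℕₚ.<⇒≤ (²-cancel-< (begin-strict
    (a ℕ.* suc n) ℕ.* (a ℕ.* suc n)
      ≡⟨ N.solve 2 (λ a n → (a N.:* n) N.:* (a N.:* n) N.:= (a N.:* a) N.:* (n N.:* n))
           refl a (suc n) ⟩
    (a ℕ.* a) ℕ.* (suc n ℕ.* suc n)
      ≤⟨ ℕₚ.*-monoˡ-≤ (suc n ℕ.* suc n) (isqrt²≤ (k ℕ.* (suc m ℕ.* suc m))) ⟩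
    (k ℕ.* (suc m ℕ.* suc m)) ℕ.* (suc n ℕ.* suc n)
      ≡⟨ N.solve 3 (λ k m n → (k N.:* m) N.:* n N.:= (k N.:* n) N.:* m)
           refl k (suc m ℕ.* suc m) (suc n ℕ.* suc n) ⟩
    (k ℕ.* (suc n ℕ.* suc n)) ℕ.* (suc m ℕ.* suc m)
      <⟨ ℕₚ.*-monoˡ-< (suc m ℕ.* suc m) (<[1+isqrt]² (k ℕ.* (suc n ℕ.* suc n))) ⟩
    (b ℕ.* b) ℕ.* (suc m ℕ.* suc m)
      ≡⟨ N.solve 2 (λ b m → (b N.:* b) N.:* (m N.:* m) N.:= (b N.:* m) N.:* (b N.:* m))
           refl b (suc m) ⟩
    (b ℕ.* suc m) ℕ.* (b ℕ.* suc m) ∎))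
    where
    open ℕₚ.≤-Reasoning
    a = isqrt (k ℕ.* (suc m ℕ.* suc m))
    b = suc (isqrt (k ℕ.* (suc n ℕ.* suc n)))

-- The n-th approximation is ⌊√(k(n+1)²)⌋/(n+1), within 1/(n+1) of √k.
√_ : ℕ → ℝ
(√ k) .seq n = ℤ.+ isqrt (k ℕ.* (suc n ℕ.* suc n)) ℚ./ suc n
(√ k) .cauchy ε 0<ε with 1/n≤ ε 0<ε
... | N , small = N , λ m n m≥ n≥ → within (seq (√ k) m) (seq (√ k) n) (side m n (small n n≥)) (side n m (small m m≥))
  where
  open ℚₚ.≤-Reasoning
  side : ∀ m n → (ℤ.+ 1 ℚ./ suc n) ℚ.≤ ε → seq (√ k) m ℚ.≤ seq (√ k) n ℚ.+ ε
  side m n 1/n≤ε = begin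
    seq (√ k) m
      ≤⟨ /-≤ (isqrt (k ℕ.* (suc m ℕ.* suc m))) m
             (suc (isqrt (k ℕ.* (suc n ℕ.* suc n)))) n (√-upper k m n) ⟩
    (ℤ.+ suc (isqrt (k ℕ.* (suc n ℕ.* suc n))) ℚ./ suc n)
      ≡⟨ suc/ (isqrt (k ℕ.* (suc n ℕ.* suc n))) n ⟩
    seq (√ k) n ℚ.+ (ℤ.+ 1 ℚ./ suc n)
      ≤⟨ ℚₚ.+-monoʳ-≤ (seq (√ k) n) 1/n≤ε ⟩
    seq (√ k) n ℚ.+ ε ∎

instance
  √-positive : ∀ {k} → .{{NonZero k}} → 0ℝ < √ k
  √-positive {suc k} = mk< 1ℚ (ℚₚ.positive⁻¹ 1ℚ) 0 λ n _ →
    subst (ℚ._≤ seq (√ suc k) n) (sym (ℚₚ.+-identityˡ 1ℚ))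
      (/-≤ 1 0 (r n) n (ℕₚ.≤-trans (ℕₚ.≤-reflexive (ℕₚ.*-identityˡ (suc n)))
        (ℕₚ.≤-trans (n<1+r n) (ℕₚ.≤-reflexive (sym (ℕₚ.*-identityʳ (r n)))))))
    where
    r : ℕ → ℕ
    r n = isqrt (suc k ℕ.* (suc n ℕ.* suc n))
    n<1+r : ∀ n → suc n ℕ.≤ r n
    n<1+r n = ℕₚ.≤-pred (²-cancel-< (ℕₚ.≤-<-trans
      (ℕₚ.m≤n*m (suc n ℕ.* suc n) (suc k)) (<[1+isqrt]² (suc k ℕ.* (suc n ℕ.* suc n)))))

∑ : ∀ {n} → (Fin n → ℝ) → ℝ
∑ = Vector.foldr _+_ 0ℝ

maximum : ∀ n → .{{NonZero n}} → (Fin n → ℝ) → ℝ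
maximum (suc zero)    x = x zero
maximum (suc (suc n)) x = x zero ⊔ maximum (suc n) (λ i → x (suc i))

record Instance (k : ℕ) : Set where
  field
    reward      : Fin k → ℕ → ℝ
    nonneg      : ∀ i t → 0ℝ ≤ reward i t
    start       : ∀ i → reward i 0 ≈ 0ℝ
    mono        : ∀ i t → reward i t ≤ reward i (suc t)
    diminishing : ∀ i t → reward i (suc (suc t)) - reward i (suc t) ≤
                          reward i (suc t) - reward i t

record Distribution (k : ℕ) : Set where
  field
    prob       : Fin k → ℝ
    nonneg     : ∀ i → 0ℝ ≤ prob i
    normalised : ∑ prob ≈ 1ℝ

-- The pulls made so far with the rewards they yielded, most recent first.
History : ℕ → Set
History k = List (Fin k × ℝ)

-- A randomized algorithm is given by the conditional distribution of its next
-- pull given everything it has observed. It need not respect _≈_ on rewards: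
-- constructively, comparing a reward with a threshold does not.
Algorithm : ℕ → Set
Algorithm k = History k → Distribution k

module _ {k : ℕ} where

  pulls : Fin k → History k → ℕ
  pulls i h = length (filter (i ≟_) (map proj₁ h))

  pull : Instance k → Fin k → History k → History k
  pull I i h = (i , Instance.reward I i (suc (pulls i h))) ∷ h

  totalReward : History k → ℝ
  totalReward h = foldr _+_ 0ℝ (map proj₂ h)

  -- Expectation of g over the history reached from h after n further pulls.
  𝔼 : Algorithm k → Instance k → (n : ℕ) → (History k → ℝ) → History k → ℝ
  𝔼 A I zero    g h = g h
  𝔼 A I (suc n) g h =
    ∑ λ i → Distribution.prob (A h) i * 𝔼 A I n g (pull I i h)

  ALG : Algorithm k → Instance k → ℕ → ℝ
  ALG A I T = 𝔼 A I T totalReward []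

  OPT : .{{NonZero k}} → Instance k → ℕ → ℝ
  OPT I T = maximum k λ i → ∑ {T} λ t → Instance.reward I i (suc (toℕ t))

{-# OPTIONS --safe #-}

-- Let s = ⌊T/√k⌋ and M = T(T+1)/2. In the base instance every arm i has reward min(t, s);
-- in the instance boosted at j, arm j has reward t instead, as min(t, T): the cap T is not
-- felt within the horizon. Until arm j is pulled s + 1 times the two are indistinguishable
-- and every reward is at most s, while any run collects at most M = OPT. Charging M/(s+1)
-- to each pull of arm j gives, by coupling,
--   ALG(boosted j) ≤ T s + M/(s+1) · E_base[pulls of j].
-- The expected pulls under the base instance add up to T, so some arm has at most about
-- T/k of them, and then both terms are O(M/√k).
module Submission where

open import Algebra.Bundles using (CommutativeSemiring)
import Algebra.Properties.Semiring.Sum as SemiringSum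
import Algebra.Solver.Ring.NaturalCoefficients.Default as SemiringSolver
open import Algebra.Structures.Biased using (isCommutativeMonoidˡ; isCommutativeSemiringˡ)
open import Data.Fin using (Fin; zero; suc; toℕ; _≟_)
open import Data.Fin.Properties using (toℕ<n)
import Data.Integer as ℤ
import Data.Integer.Properties as ℤₚ
open import Data.List using ([]; _∷_; length; map)
import Data.List.Properties as Listₚ
open import Data.Nat as ℕ using (ℕ; zero; suc; NonZero)
open import Data.Nat.DivMod using (m/n*n≤m; m≡m%n+[m/n]*n; m%n<n)
import Data.Nat.Properties as ℕₚ
import Data.Nat.Solver as ℕ-Solver
open import Data.Product using (∃-syntax; _×_; _,_; proj₁; proj₂)
open import Data.Rational as ℚ using (ℚ; 0ℚ; 1ℚ; ½; ∣_∣)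
import Data.Rational.Properties as ℚₚ
import Data.Rational.Solver as ℚ-Solver
import Data.Rational.Unnormalised as ℚᵘ
import Data.Rational.Unnormalised.Properties as ℚᵘₚ
open import Data.Sum using (_⊎_; inj₁; inj₂; [_,_]′)
open import Data.Unit using (⊤; tt)
open import Data.Vec.Functional using (updateAt)
open import Data.Vec.Functional.Properties using (updateAt-updates; updateAt-minimal)
open import Function using (_∘_; const)
open import Relation.Binary.Bundles using (Preorder; Setoid)
open import Relation.Binary.PropositionalEquality
  using (_≡_; _≢_; refl; sym; trans; cong; cong₂; subst; subst₂; ≢-sym)
import Relation.Binary.Reasoning.Preorder as PreorderReasoning
import Relation.Binary.Reasoning.Setoid as SetoidReasoning
open import Relation.Binary.Structures using (IsEquivalence)
open import Relation.Nullary using (¬_; yes; no; contradiction)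
open import Defs

-- Arithmetic of rationals.

private
  module N = ℕ-Solver.+-*-Solver
  module Q = ℚ-Solver.+-*-Solver

  ½-double : ∀ ε → ½ ℚ.* ε ℚ.+ ½ ℚ.* ε ≡ ε
  ½-double ε = trans (sym (ℚₚ.*-distribʳ-+ ε ½ ½)) (ℚₚ.*-identityˡ ε)

  0<p*q : ∀ {p q} → 0ℚ ℚ.< p → 0ℚ ℚ.< q → 0ℚ ℚ.< p ℚ.* q
  0<p*q {p} {q} 0<p 0<q = ℚₚ.positive⁻¹ (p ℚ.* q)
    where instance
      _ = ℚ.positive 0<p
      _ = ℚ.positive 0<q
      _ = ℚₚ.pos*pos⇒pos p q

  0<½*p : ∀ {p} → 0ℚ ℚ.< p → 0ℚ ℚ.< ½ ℚ.* p
  0<½*p = 0<p*q (ℚₚ.positive⁻¹ ½)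

  p≤p+q : ∀ p {q} → 0ℚ ℚ.≤ q → p ℚ.≤ p ℚ.+ q
  p≤p+q p {q} 0≤q = subst (ℚ._≤ p ℚ.+ q) (ℚₚ.+-identityʳ p) (ℚₚ.+-monoʳ-≤ p 0≤q)

  p≤∣p∣ : ∀ p → p ℚ.≤ ∣ p ∣
  p≤∣p∣ p with ℚₚ.≤-total 0ℚ p
  ... | inj₁ 0≤p = ℚₚ.≤-reflexive (sym (ℚₚ.0≤p⇒∣p∣≡p 0≤p))
  ... | inj₂ p≤0 = ℚₚ.≤-trans p≤0 (ℚₚ.0≤∣p∣ p)

  ∣p-q∣≡∣q-p∣ : ∀ p q → ∣ p ℚ.- q ∣ ≡ ∣ q ℚ.- p ∣
  ∣p-q∣≡∣q-p∣ p q = trans (sym (ℚₚ.∣-p∣≡∣p∣ (p ℚ.- q)))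
    (cong ∣_∣ (Q.solve 2 (λ p q → Q.:- (p Q.:- q) Q.:= q Q.:- p) refl p q))

  ∣p-q∣≤r⇒p≤q+r : ∀ p q {r} → ∣ p ℚ.- q ∣ ℚ.≤ r → p ℚ.≤ q ℚ.+ r
  ∣p-q∣≤r⇒p≤q+r p q ∣p-q∣≤r = subst (ℚ._≤ _)
    (Q.solve 2 (λ p q → q Q.:+ (p Q.:- q) Q.:= p) refl p q)
    (ℚₚ.+-monoʳ-≤ q (ℚₚ.≤-trans (p≤∣p∣ (p ℚ.- q)) ∣p-q∣≤r))

  ∣p-q∣≤r⇒q≤p+r : ∀ p q {r} → ∣ p ℚ.- q ∣ ℚ.≤ r → q ℚ.≤ p ℚ.+ r
  ∣p-q∣≤r⇒q≤p+r p q = ∣p-q∣≤r⇒p≤q+r q p ∘ subst (ℚ._≤ _) (∣p-q∣≡∣q-p∣ p q)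

  p≤q+r⇒p-q≤r : ∀ p q {r} → p ℚ.≤ q ℚ.+ r → p ℚ.- q ℚ.≤ r
  p≤q+r⇒p-q≤r p q {r} p≤q+r = subst (p ℚ.- q ℚ.≤_)
    (Q.solve 2 (λ q r → (q Q.:+ r) Q.:- q Q.:= r) refl q r)
    (ℚₚ.+-monoˡ-≤ (ℚ.- q) p≤q+r)

  ∣p-q∣≤r : ∀ p q {r} → p ℚ.≤ q ℚ.+ r → q ℚ.≤ p ℚ.+ r → ∣ p ℚ.- q ∣ ℚ.≤ r
  ∣p-q∣≤r p q p≤q+r q≤p+r with ℚₚ.∣p∣≡p∨∣p∣≡-p (p ℚ.- q)
  ... | inj₁ ∣p-q∣≡p-q  = subst (ℚ._≤ _) (sym ∣p-q∣≡p-q) (p≤q+r⇒p-q≤r p q p≤q+r)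
  ... | inj₂ ∣p-q∣≡-p+q = subst (ℚ._≤ _)
    (trans (Q.solve 2 (λ p q → q Q.:- p Q.:= Q.:- (p Q.:- q)) refl p q) (sym ∣p-q∣≡-p+q))
    (p≤q+r⇒p-q≤r q p q≤p+r)

  toℚᵘ-/ : ∀ i n → ℚ.toℚᵘ (i ℚ./ suc n) ℚᵘ.≃ ℚᵘ.mkℚᵘ i n
  toℚᵘ-/ i n = ℚₚ.toℚᵘ-fromℚᵘ (ℚᵘ.mkℚᵘ i n)

  /-mono-≤ : ∀ a b c d → a ℕ.* suc d ℕ.≤ c ℕ.* suc b →
             (ℤ.+ a ℚ./ suc b) ℚ.≤ (ℤ.+ c ℚ./ suc d)
  /-mono-≤ a b c d ad≤cb = ℚₚ.toℚᵘ-cancel-≤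
    (ℚᵘₚ.≤-respˡ-≃ (ℚᵘₚ.≃-sym (toℚᵘ-/ (ℤ.+ a) b))
    (ℚᵘₚ.≤-respʳ-≃ (ℚᵘₚ.≃-sym (toℚᵘ-/ (ℤ.+ c) d))
      (ℚᵘ.*≤* (subst₂ ℤ._≤_ (ℤₚ.pos-* a (suc d)) (ℤₚ.pos-* c (suc b)) (ℤ.+≤+ ad≤cb)))))

  /1-+ : ∀ m n → (ℤ.+ (m ℕ.+ n) ℚ./ 1) ≡ (ℤ.+ m ℚ./ 1) ℚ.+ (ℤ.+ n ℚ./ 1)
  /1-+ m n = ℚₚ.toℚᵘ-injective (begin
    ℚ.toℚᵘ (ℤ.+ (m ℕ.+ n) ℚ./ 1)
      ≈⟨ toℚᵘ-/ (ℤ.+ (m ℕ.+ n)) 0 ⟩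
    ℚᵘ.mkℚᵘ (ℤ.+ (m ℕ.+ n)) 0
      ≡⟨ cong₂ (λ i j → ℚᵘ.mkℚᵘ (i ℤ.+ j) 0)
           (ℤₚ.*-identityʳ (ℤ.+ m)) (ℤₚ.*-identityʳ (ℤ.+ n)) ⟨
    ℚᵘ.mkℚᵘ (ℤ.+ m) 0 ℚᵘ.+ ℚᵘ.mkℚᵘ (ℤ.+ n) 0
      ≈⟨ ℚᵘₚ.+-cong (toℚᵘ-/ (ℤ.+ m) 0) (toℚᵘ-/ (ℤ.+ n) 0) ⟨
    ℚ.toℚᵘ (ℤ.+ m ℚ./ 1) ℚᵘ.+ ℚ.toℚᵘ (ℤ.+ n ℚ./ 1)
      ≈⟨ ℚₚ.toℚᵘ-homo-+ (ℤ.+ m ℚ./ 1) (ℤ.+ n ℚ./ 1) ⟨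
    ℚ.toℚᵘ ((ℤ.+ m ℚ./ 1) ℚ.+ (ℤ.+ n ℚ./ 1)) ∎)
    where open SetoidReasoning ℚᵘₚ.≃-setoid

  /-* : ∀ a c d → (ℤ.+ (a ℕ.* c) ℚ./ suc d) ≡ (ℤ.+ a ℚ./ 1) ℚ.* (ℤ.+ c ℚ./ suc d)
  /-* a c d = ℚₚ.toℚᵘ-injective (begin
    ℚ.toℚᵘ (ℤ.+ (a ℕ.* c) ℚ./ suc d)
      ≈⟨ toℚᵘ-/ (ℤ.+ (a ℕ.* c)) d ⟩
    ℚᵘ.mkℚᵘ (ℤ.+ (a ℕ.* c)) d
      ≡⟨ cong₂ ℚᵘ.mkℚᵘ (ℤₚ.pos-* a c) (sym (ℕₚ.+-identityʳ d)) ⟩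
    ℚᵘ.mkℚᵘ (ℤ.+ a) 0 ℚᵘ.* ℚᵘ.mkℚᵘ (ℤ.+ c) d
      ≈⟨ ℚᵘₚ.*-cong (toℚᵘ-/ (ℤ.+ a) 0) (toℚᵘ-/ (ℤ.+ c) d) ⟨
    ℚ.toℚᵘ (ℤ.+ a ℚ./ 1) ℚᵘ.* ℚ.toℚᵘ (ℤ.+ c ℚ./ suc d)
      ≈⟨ ℚₚ.toℚᵘ-homo-* (ℤ.+ a ℚ./ 1) (ℤ.+ c ℚ./ suc d) ⟨
    ℚ.toℚᵘ ((ℤ.+ a ℚ./ 1) ℚ.* (ℤ.+ c ℚ./ suc d)) ∎)
    where open SetoidReasoning ℚᵘₚ.≃-setoid

-- Equality and order of Cauchy reals.

≗⇒≈ : ∀ {x y} → (∀ n → seq x n ≡ seq y n) → x ≈ y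
≗⇒≈ {x} {y} x≗y = mk≈ λ ε 0<ε → 0 , λ n _ → subst (λ p → ∣ seq x n ℚ.- p ∣ ℚ.≤ ε) (x≗y n)
  (subst (λ p → ∣ p ∣ ℚ.≤ ε) (sym (ℚₚ.+-inverseʳ (seq x n))) (ℚₚ.<⇒≤ 0<ε))

≤-pointwise : ∀ {x y} → (∀ n → seq x n ℚ.≤ seq y n) → x ≤ y
≤-pointwise {x} {y} x≤y = mk≤ λ ε 0<ε → 0 , λ n _ →
  ℚₚ.≤-trans (x≤y n) (p≤p+q (seq y n) (ℚₚ.<⇒≤ 0<ε))

≤-antisym : ∀ {x y} → x ≤ y → y ≤ x → x ≈ y
≤-antisym {x} {y} (mk≤ x≤y) (mk≤ y≤x) = mk≈ λ ε 0<ε →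
  let M , p = x≤y ε 0<ε
      N , q = y≤x ε 0<ε
  in M ℕ.⊔ N , λ n n≥ → ∣p-q∣≤r (seq x n) (seq y n)
       (p n (ℕₚ.m⊔n≤o⇒m≤o M N n≥)) (q n (ℕₚ.m⊔n≤o⇒n≤o M N n≥))

≤-reflexive : ∀ {x y} → x ≈ y → x ≤ y
≤-reflexive {x} {y} (mk≈ x≈y) = mk≤ λ ε 0<ε →
  let N , p = x≈y ε 0<ε in N , λ n n≥ → ∣p-q∣≤r⇒p≤q+r (seq x n) (seq y n) (p n n≥)

≤-trans : ∀ {x y z} → x ≤ y → y ≤ z → x ≤ z
≤-trans {x} {y} {z} (mk≤ x≤y) (mk≤ y≤z) = mk≤ λ ε 0<ε →
  let M , p = x≤y (½ ℚ.* ε) (0<½*p 0<ε)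
      N , q = y≤z (½ ℚ.* ε) (0<½*p 0<ε)
  in M ℕ.⊔ N , λ n n≥ → begin
    seq x n
      ≤⟨ p n (ℕₚ.m⊔n≤o⇒m≤o M N n≥) ⟩
    seq y n ℚ.+ ½ ℚ.* ε
      ≤⟨ ℚₚ.+-monoˡ-≤ (½ ℚ.* ε) (q n (ℕₚ.m⊔n≤o⇒n≤o M N n≥)) ⟩
    seq z n ℚ.+ ½ ℚ.* ε ℚ.+ ½ ℚ.* ε
      ≡⟨ trans (ℚₚ.+-assoc (seq z n) _ _) (cong (seq z n ℚ.+_) (½-double ε)) ⟩
    seq z n ℚ.+ ε ∎
  where open ℚₚ.≤-Reasoning

≈-sym : ∀ {x y} → x ≈ y → y ≈ x
≈-sym {x} {y} (mk≈ x≈y) = mk≈ λ ε 0<ε → let N , p = x≈y ε 0<ε in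
  N , λ n n≥ → subst (ℚ._≤ ε) (∣p-q∣≡∣q-p∣ (seq x n) (seq y n)) (p n n≥)

≈-isEquivalence : IsEquivalence _≈_
≈-isEquivalence = record
  { refl  = ≗⇒≈ λ _ → refl
  ; sym   = ≈-sym
  ; trans = λ x≈y y≈z → ≤-antisym
      (≤-trans (≤-reflexive x≈y) (≤-reflexive y≈z))
      (≤-trans (≤-reflexive (≈-sym y≈z)) (≤-reflexive (≈-sym x≈y)))
  }

≤-preorder : Preorder _ _ _
≤-preorder = record
  { _≈_        = _≈_
  ; _≲_        = _≤_
  ; isPreorder = record
    { isEquivalence = ≈-isEquivalence
    ; reflexive     = ≤-reflexive
    ; trans         = ≤-trans
    }
  }

≈-setoid : Setoid _ _
≈-setoid = record { isEquivalence = ≈-isEquivalence }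

module ≈-Reasoning = SetoidReasoning ≈-setoid
module ≤-Reasoning = PreorderReasoning ≤-preorder

-- The commutative semiring of reals.

+-mono-≤ : ∀ {x x′ y y′} → x ≤ x′ → y ≤ y′ → x + y ≤ x′ + y′
+-mono-≤ {x} {x′} {y} {y′} (mk≤ x≤x′) (mk≤ y≤y′) = mk≤ λ ε 0<ε →
  let M , p = x≤x′ (½ ℚ.* ε) (0<½*p 0<ε)
      N , q = y≤y′ (½ ℚ.* ε) (0<½*p 0<ε)
  in M ℕ.⊔ N , λ n n≥ → begin
    seq x n ℚ.+ seq y n
      ≤⟨ ℚₚ.+-mono-≤ (p n (ℕₚ.m⊔n≤o⇒m≤o M N n≥)) (q n (ℕₚ.m⊔n≤o⇒n≤o M N n≥)) ⟩
    (seq x′ n ℚ.+ ½ ℚ.* ε) ℚ.+ (seq y′ n ℚ.+ ½ ℚ.* ε)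
      ≡⟨ Q.solve 3 (λ a b e → (a Q.:+ e) Q.:+ (b Q.:+ e) Q.:= (a Q.:+ b) Q.:+ (e Q.:+ e))
           refl (seq x′ n) (seq y′ n) (½ ℚ.* ε) ⟩
    (seq x′ n ℚ.+ seq y′ n) ℚ.+ (½ ℚ.* ε ℚ.+ ½ ℚ.* ε)
      ≡⟨ cong ((seq x′ n ℚ.+ seq y′ n) ℚ.+_) (½-double ε) ⟩
    (seq x′ n ℚ.+ seq y′ n) ℚ.+ ε ∎
  where open ℚₚ.≤-Reasoning

+-cong : ∀ {x x′ y y′} → x ≈ x′ → y ≈ y′ → x + y ≈ x′ + y′
+-cong x≈x′ y≈y′ = ≤-antisym
  (+-mono-≤ (≤-reflexive x≈x′) (≤-reflexive y≈y′))
  (+-mono-≤ (≤-reflexive (≈-sym x≈x′)) (≤-reflexive (≈-sym y≈y′)))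

-- Past the modulus for tolerance 1, every term lies within 1 of one fixed term. Such a bound `B`
-- makes multiplication respect `_≈_`: a tolerance `ε` for the product is met by `ε / B` for the
-- other factor.
eventually-bounded : ∀ x → ∃[ B ] (0ℚ ℚ.< B) × ∃[ N ] ∀ n → N ℕ.≤ n → ∣ seq x n ∣ ℚ.≤ B
eventually-bounded x =
  let N , p = cauchy x 1ℚ (ℚₚ.positive⁻¹ 1ℚ)
      b     = ∣ seq x N ∣
  in b ℚ.+ 1ℚ , ℚₚ.<-≤-trans (ℚₚ.positive⁻¹ 1ℚ)
       (subst (1ℚ ℚ.≤_) (ℚₚ.+-comm 1ℚ b) (p≤p+q 1ℚ (ℚₚ.0≤∣p∣ (seq x N)))) ,
     N , λ n n≥ → begin
       ∣ seq x n ∣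
         ≡⟨ cong ∣_∣ (Q.solve 2 (λ p q → p Q.:= q Q.:+ (p Q.:- q)) refl (seq x n) (seq x N)) ⟩
       ∣ seq x N ℚ.+ (seq x n ℚ.- seq x N) ∣
         ≤⟨ ℚₚ.∣p+q∣≤∣p∣+∣q∣ (seq x N) (seq x n ℚ.- seq x N) ⟩
       ∣ seq x N ∣ ℚ.+ ∣ seq x n ℚ.- seq x N ∣
         ≤⟨ ℚₚ.+-monoʳ-≤ ∣ seq x N ∣ (p n N n≥ ℕₚ.≤-refl) ⟩
       ∣ seq x N ∣ ℚ.+ 1ℚ ∎
  where open ℚₚ.≤-Reasoning

private
  *-congˡ : ∀ z {x y} → x ≈ y → z * x ≈ z * y
  *-congˡ z {x} {y} (mk≈ x≈y) = mk≈ λ ε 0<ε →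
    let B , 0<B , M , bound = eventually-bounded z
        instance
          B-pos     = ℚ.positive 0<B
          B-nonZero = ℚₚ.pos⇒nonZero B
          1/B-pos   = ℚₚ.1/pos⇒pos B
        N , close = x≈y (ε ℚ.* ℚ.1/ B) (0<p*q 0<ε (ℚₚ.positive⁻¹ (ℚ.1/ B)))
    in M ℕ.⊔ N , λ n n≥ →
      let a = seq z n ; b = seq x n ; c = seq y n in begin
      ∣ a ℚ.* b ℚ.- a ℚ.* c ∣
        ≡⟨ cong ∣_∣ (Q.solve 3 (λ a b c → a Q.:* b Q.:- a Q.:* c Q.:= a Q.:* (b Q.:- c))
             refl a b c) ⟩
      ∣ a ℚ.* (b ℚ.- c) ∣
        ≡⟨ ℚₚ.∣p*q∣≡∣p∣*∣q∣ a (b ℚ.- c) ⟩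
      ∣ a ∣ ℚ.* ∣ b ℚ.- c ∣
        ≤⟨ ℚₚ.*-monoʳ-≤-nonNeg ∣ b ℚ.- c ∣ {{ℚₚ.∣-∣-nonNeg (b ℚ.- c)}}
             (bound n (ℕₚ.m⊔n≤o⇒m≤o M N n≥)) ⟩
      B ℚ.* ∣ b ℚ.- c ∣
        ≤⟨ ℚₚ.*-monoˡ-≤-nonNeg B {{ℚₚ.pos⇒nonNeg B}} (close n (ℕₚ.m⊔n≤o⇒n≤o M N n≥)) ⟩
      B ℚ.* (ε ℚ.* ℚ.1/ B)
        ≡⟨ Q.solve 3 (λ b e i → b Q.:* (e Q.:* i) Q.:= e Q.:* (b Q.:* i)) refl B ε (ℚ.1/ B) ⟩
      ε ℚ.* (B ℚ.* ℚ.1/ B)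
        ≡⟨ trans (cong (ε ℚ.*_) (ℚₚ.*-inverseʳ B)) (ℚₚ.*-identityʳ ε) ⟩
      ε ∎
    where open ℚₚ.≤-Reasoning

*-comm : ∀ x y → x * y ≈ y * x
*-comm x y = ≗⇒≈ λ n → ℚₚ.*-comm (seq x n) (seq y n)

*-cong : ∀ {x x′ y y′} → x ≈ x′ → y ≈ y′ → x * y ≈ x′ * y′
*-cong {x} {x′} {y} {y′} x≈x′ y≈y′ = begin
  x * y    ≈⟨ *-congˡ x y≈y′ ⟩
  x * y′   ≈⟨ *-comm x y′ ⟩
  y′ * x   ≈⟨ *-congˡ y′ x≈x′ ⟩
  y′ * x′  ≈⟨ *-comm y′ x′ ⟩
  x′ * y′  ∎
  where open ≈-Reasoning

ℝ-commutativeSemiring : CommutativeSemiring _ _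
ℝ-commutativeSemiring = record
  { Carrier = ℝ
  ; _≈_     = _≈_
  ; _+_     = _+_
  ; _*_     = _*_
  ; 0#      = 0ℝ
  ; 1#      = 1ℝ
  ; isCommutativeSemiring = isCommutativeSemiringˡ record
    { +-isCommutativeMonoid = isCommutativeMonoidˡ record
      { isSemigroup = record
        { isMagma = record { isEquivalence = ≈-isEquivalence ; ∙-cong = +-cong }
        ; assoc   = λ x y z → ≗⇒≈ λ n → ℚₚ.+-assoc (seq x n) (seq y n) (seq z n)
        }
      ; identityˡ = λ x → ≗⇒≈ λ n → ℚₚ.+-identityˡ (seq x n)
      ; comm      = λ x y → ≗⇒≈ λ n → ℚₚ.+-comm (seq x n) (seq y n)
      }
    ; *-isCommutativeMonoid = isCommutativeMonoidˡ record
      { isSemigroup = record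
        { isMagma = record { isEquivalence = ≈-isEquivalence ; ∙-cong = *-cong }
        ; assoc   = λ x y z → ≗⇒≈ λ n → ℚₚ.*-assoc (seq x n) (seq y n) (seq z n)
        }
      ; identityˡ = λ x → ≗⇒≈ λ n → ℚₚ.*-identityˡ (seq x n)
      ; comm      = *-comm
      }
    ; distribʳ = λ x y z → ≗⇒≈ λ n → ℚₚ.*-distribʳ-+ (seq x n) (seq y n) (seq z n)
    ; zeroˡ    = λ x → ≗⇒≈ λ n → ℚₚ.*-zeroˡ (seq x n)
    }
  }

module R = CommutativeSemiring ℝ-commutativeSemiring
module ∑ = SemiringSum R.semiring
module ∑ℕ = SemiringSum ℕₚ.+-*-semiring
module S = SemiringSolver ℝ-commutativeSemiring

-- Order of products, maxima and finite sums.

private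
  x≤y⇒x⊔y≈y : ∀ {x y} → x ≤ y → x ⊔ y ≈ y
  x≤y⇒x⊔y≈y {x} {y} (mk≤ x≤y) = ≤-antisym
    (mk≤ λ ε 0<ε → let N , p = x≤y ε 0<ε in
      N , λ n n≥ → ℚₚ.⊔-lub (p n n≥) (p≤p+q (seq y n) (ℚₚ.<⇒≤ 0<ε)))
    (≤-pointwise λ n → ℚₚ.p≤q⊔p (seq x n) (seq y n))

-- Replacing z by 0 ⊔ z and y by x ⊔ y changes neither of them up to _≈_ and makes
-- both hypotheses hold termwise.
*-monoˡ-≤ : ∀ z {x y} → 0ℝ ≤ z → x ≤ y → z * x ≤ z * y
*-monoˡ-≤ z {x} {y} 0≤z x≤y = begin
  z * x               ≈⟨ *-cong (x≤y⇒x⊔y≈y 0≤z) R.refl ⟨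
  (0ℝ ⊔ z) * x        ≲⟨ ≤-pointwise (λ n → ℚₚ.*-monoˡ-≤-nonNeg (0ℚ ℚ.⊔ seq z n)
                           {{ℚ.nonNegative (ℚₚ.p≤p⊔q 0ℚ (seq z n))}}
                           (ℚₚ.p≤p⊔q (seq x n) (seq y n))) ⟩
  (0ℝ ⊔ z) * (x ⊔ y)  ≈⟨ *-cong (x≤y⇒x⊔y≈y 0≤z) (x≤y⇒x⊔y≈y x≤y) ⟩
  z * y               ∎
  where open ≤-Reasoning

*-monoʳ-≤ : ∀ z {x y} → 0ℝ ≤ z → x ≤ y → x * z ≤ y * z
*-monoʳ-≤ z {x} {y} 0≤z x≤y = begin
  x * z  ≈⟨ *-comm x z ⟩
  z * x  ≲⟨ *-monoˡ-≤ z 0≤z x≤y ⟩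
  z * y  ≈⟨ *-comm z y ⟩
  y * z  ∎
  where open ≤-Reasoning

-- Since `_≤_` holds termwise only up to a tolerance, half of the gap is spent on it and the other
-- half survives.
<-≤-trans : ∀ {x y z} → x < y → y ≤ z → x < z
<-≤-trans {x} {y} {z} (mk< γ 0<γ M p) (mk≤ y≤z) =
  let δ     = ½ ℚ.* γ
      N , q = y≤z δ (0<½*p 0<γ)
  in mk< δ (0<½*p 0<γ) (M ℕ.⊔ N) λ n n≥ →
    let a = seq x n ; b = seq y n ; c = seq z n in begin
    a ℚ.+ δ
      ≡⟨ Q.solve 2 (λ a d → a Q.:+ d Q.:= (a Q.:+ (d Q.:+ d)) Q.:- d) refl a δ ⟩
    a ℚ.+ (δ ℚ.+ δ) ℚ.- δ
      ≡⟨ cong (λ e → a ℚ.+ e ℚ.- δ) (½-double γ) ⟩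
    a ℚ.+ γ ℚ.- δ
      ≤⟨ ℚₚ.+-monoˡ-≤ (ℚ.- δ) (ℚₚ.≤-trans (p n (ℕₚ.m⊔n≤o⇒m≤o M N n≥))
                                         (q n (ℕₚ.m⊔n≤o⇒n≤o M N n≥))) ⟩
    (c ℚ.+ δ) ℚ.- δ
      ≡⟨ Q.solve 2 (λ c d → (c Q.:+ d) Q.:- d Q.:= c) refl c δ ⟩
    c ∎
  where open ℚₚ.≤-Reasoning

≤-maximum : ∀ n .{{_ : NonZero n}} (x : Fin n → ℝ) i → x i ≤ maximum n x
≤-maximum (suc zero)    x zero    = ≤-reflexive R.refl
≤-maximum (suc (suc n)) x zero    = ≤-pointwise λ m → ℚₚ.p≤p⊔q (seq (x zero) m) _
≤-maximum (suc (suc n)) x (suc i) = ≤-trans (≤-maximum (suc n) (x ∘ suc) i)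
  (≤-pointwise λ m → ℚₚ.p≤q⊔p (seq (x zero) m) _)

∑-mono-≤ : ∀ {n} {x y : Fin n → ℝ} → (∀ i → x i ≤ y i) → ∑ x ≤ ∑ y
∑-mono-≤ {zero}  x≤y = ≤-reflexive R.refl
∑-mono-≤ {suc n} x≤y = +-mono-≤ (x≤y zero) (∑-mono-≤ (x≤y ∘ suc))

-- The embedding of the naturals.

fromℕ-mono-≤ : ∀ {m n} → m ℕ.≤ n → fromℕ m ≤ fromℕ n
fromℕ-mono-≤ {m} {n} m≤n = ≤-pointwise λ _ → /-mono-≤ m 0 n 0 (ℕₚ.*-monoˡ-≤ 1 m≤n)

0≤fromℕ : ∀ n → 0ℝ ≤ fromℕ n
0≤fromℕ n = fromℕ-mono-≤ ℕ.z≤n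

fromℕ-+ : ∀ m n → fromℕ (m ℕ.+ n) ≈ fromℕ m + fromℕ n
fromℕ-+ m n = ≗⇒≈ λ _ → /1-+ m n

fromℕ-* : ∀ m n → fromℕ (m ℕ.* n) ≈ fromℕ m * fromℕ n
fromℕ-* m n = ≗⇒≈ λ _ → /-* m n 0

fromℕ-∑ : ∀ {n} (f : Fin n → ℕ) → fromℕ (∑ℕ.sum f) ≈ ∑ (fromℕ ∘ f)
fromℕ-∑ {zero}  f = R.refl
fromℕ-∑ {suc n} f = R.trans (fromℕ-+ (f zero) _) (+-cong R.refl (fromℕ-∑ (f ∘ suc)))

∑-const : ∀ n x → ∑ {n} (λ _ → x) ≈ fromℕ n * x
∑-const zero    x = R.sym (R.zeroˡ x)
∑-const (suc n) x = begin
  x + ∑ {n} (λ _ → x)       ≈⟨ +-cong (R.sym (R.*-identityˡ x)) (∑-const n x) ⟩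
  1ℝ * x + fromℕ n * x      ≈⟨ R.distribʳ x 1ℝ (fromℕ n) ⟨
  (1ℝ + fromℕ n) * x        ≈⟨ *-cong (fromℕ-+ 1 n) R.refl ⟨
  fromℕ (suc n) * x         ∎
  where open ≈-Reasoning

fromℕ-mono-< : ∀ {m n} → m ℕ.< n → fromℕ m < fromℕ n
fromℕ-mono-< {m} {n} m<n = mk< 1ℚ (ℚₚ.positive⁻¹ 1ℚ) 0 λ _ _ → begin
  (ℤ.+ m ℚ./ 1) ℚ.+ 1ℚ  ≡⟨ ℚₚ.+-comm (ℤ.+ m ℚ./ 1) 1ℚ ⟩
  1ℚ ℚ.+ (ℤ.+ m ℚ./ 1)  ≡⟨ /1-+ 1 m ⟨
  ℤ.+ suc m ℚ./ 1       ≤⟨ /-mono-≤ (suc m) 0 n 0 (ℕₚ.*-monoˡ-≤ 1 m<n) ⟩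
  ℤ.+ n ℚ./ 1           ∎
  where open ℚₚ.≤-Reasoning

<⇒≱ : ∀ {x y} → x < y → ¬ (y ≤ x)
<⇒≱ {x} {y} (mk< γ 0<γ M x+γ≤y) (mk≤ y≤x) =
  let N , q = y≤x (½ ℚ.* γ) (0<½*p 0<γ)
      n     = M ℕ.⊔ N
  in ℚₚ.<-irrefl refl (begin-strict
    seq x n ℚ.+ ½ ℚ.* γ
      <⟨ ℚₚ.+-monoʳ-< (seq x n) (subst (½ ℚ.* γ ℚ.<_) (½-double γ)
           (subst (ℚ._< ½ ℚ.* γ ℚ.+ ½ ℚ.* γ) (ℚₚ.+-identityʳ (½ ℚ.* γ))
             (ℚₚ.+-monoʳ-< (½ ℚ.* γ) (0<½*p 0<γ)))) ⟩
    seq x n ℚ.+ γ        ≤⟨ x+γ≤y n (ℕₚ.m≤m⊔n M N) ⟩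
    seq y n              ≤⟨ q n (ℕₚ.m≤n⊔m M N) ⟩
    seq x n ℚ.+ ½ ℚ.* γ  ∎)
  where open ℚₚ.≤-Reasoning

-- The order of ℕ is decidable, so refuting `n < m` suffices. This brings an inequality between
-- reals back to ℕ, where it can be contradicted.
fromℕ-cancel-≤ : ∀ {m n} → fromℕ m ≤ fromℕ n → m ℕ.≤ n
fromℕ-cancel-≤ m≤n = ℕₚ.≮⇒≥ λ n<m → <⇒≱ (fromℕ-mono-< n<m) m≤n

0<fromℕ : ∀ n → .{{_ : NonZero n}} → 0ℝ < fromℕ n
0<fromℕ n = fromℕ-mono-< (ℕₚ.n≢0⇒n>0 (ℕ.≢-nonZero⁻¹ n))

-- Inverses and division.

private
  -- The divisor is a separate variable because the terms of an inverse are `1/ (p ⊔ γ)`: matching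
  -- on the equation avoids rewriting beneath the proof that the divisor is nonzero.
  p*1/q≡1 : ∀ p q .{{_ : ℚ.NonZero q}} → q ≡ p → p ℚ.* ℚ.1/ q ≡ 1ℚ
  p*1/q≡1 p .p refl = ℚₚ.*-inverseʳ p

-- From index `N` on, the terms of `x` are at least `γ`, so the maximum with `γ` in the definition
-- of the inverse changes nothing and the termwise products are exactly 1.
*-inverseʳ : ∀ x {{0<x : 0ℝ < x}} → x * x ⁻¹ ≈ 1ℝ
*-inverseʳ x {{mk< γ 0<γ N γ≤x}} = mk≈ λ ε 0<ε → N , λ n n≥ →
  let x≢0 = ℚ.>-nonZero (ℚₚ.<-≤-trans 0<γ (ℚₚ.p≤q⊔p (seq x n) γ)) in
  subst (λ p → ∣ p ℚ.- 1ℚ ∣ ℚ.≤ ε)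
    (sym (p*1/q≡1 (seq x n) (seq x n ℚ.⊔ γ) {{x≢0}}
      (ℚₚ.p≥q⇒p⊔q≡p (subst (ℚ._≤ seq x n) (ℚₚ.+-identityˡ γ) (γ≤x n n≥)))))
    (ℚₚ.<⇒≤ 0<ε)

⁻¹-nonneg : ∀ x {{0<x : 0ℝ < x}} → 0ℝ ≤ x ⁻¹
⁻¹-nonneg x {{mk< γ 0<γ N γ≤x}} = ≤-pointwise λ n →
  let instance
        _ = ℚ.positive (ℚₚ.<-≤-trans 0<γ (ℚₚ.p≤q⊔p (seq x n) γ))
  in ℚₚ.<⇒≤ (ℚₚ.positive⁻¹ _ {{ℚₚ.1/pos⇒pos (seq x n ℚ.⊔ γ)}})

x*y≤z⇒x≤z/y : ∀ x y z {{0<y : 0ℝ < y}} → x * y ≤ z → x ≤ z / y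
x*y≤z⇒x≤z/y x y z xy≤z = begin
  x                ≈⟨ R.*-identityʳ x ⟨
  x * 1ℝ           ≈⟨ *-cong R.refl (*-inverseʳ y) ⟨
  x * (y * y ⁻¹)   ≈⟨ R.*-assoc x y (y ⁻¹) ⟨
  (x * y) * y ⁻¹   ≲⟨ *-monoʳ-≤ (y ⁻¹) (⁻¹-nonneg y) xy≤z ⟩
  z / y            ∎
  where open ≤-Reasoning

*-cancelˡ-≤ : ∀ z {x y} {{0<z : 0ℝ < z}} → z * x ≤ z * y → x ≤ y
*-cancelˡ-≤ z {x} {y} zx≤zy = begin
  x                  ≲⟨ x*y≤z⇒x≤z/y x z (z * y) (≤-trans (≤-reflexive (*-comm x z)) zx≤zy) ⟩
  (z * y) * z ⁻¹     ≈⟨ S.solve 3 (λ z y i → (z S.:* y) S.:* i S.:= y S.:* (z S.:* i))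
                          R.refl z y (z ⁻¹) ⟩
  y * (z * z ⁻¹)     ≈⟨ *-cong R.refl (*-inverseʳ z) ⟩
  y * 1ℝ             ≈⟨ R.*-identityʳ y ⟩
  y                  ∎
  where open ≤-Reasoning

-- Constructive comparison and averaging.

-- The positive gap leaves room for error, so a single comparison of rational approximations, taken
-- late enough, decides between the two overlapping alternatives.
<-cotrans : ∀ {x y} → x < y → ∀ z → (z ≤ y) ⊎ (x ≤ z)
<-cotrans {x} {y} (mk< γ 0<γ L x+γ≤y) z =
  -- With `δ` a quarter of the gap, term `K` of `z` is compared with term `K` of `x` plus `2δ`.
  -- Passing from term `K` to a later term costs `δ` for each of `x` and `z`, which adds up to at
  -- most `γ`.
  decide (½ ℚ.* (½ ℚ.* γ)) (0<½*p (0<½*p 0<γ))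
    (trans (cong₂ ℚ._+_ (½-double (½ ℚ.* γ)) (½-double (½ ℚ.* γ))) (½-double γ))
  where
  open ℚₚ.≤-Reasoning
  decide : ∀ δ → 0ℚ ℚ.< δ → (δ ℚ.+ δ) ℚ.+ (δ ℚ.+ δ) ≡ γ → (z ≤ y) ⊎ (x ≤ z)
  decide δ 0<δ 4δ≡γ = compare
    where
    M   = proj₁ (cauchy x δ 0<δ)
    N   = proj₁ (cauchy z δ 0<δ)
    K   = M ℕ.⊔ N
    close-x : ∀ n → K ℕ.≤ n → ∣ seq x K ℚ.- seq x n ∣ ℚ.≤ δ
    close-x n n≥ = proj₂ (cauchy x δ 0<δ) K n (ℕₚ.m≤m⊔n M N) (ℕₚ.m⊔n≤o⇒m≤o M N n≥)
    close-z : ∀ n → K ℕ.≤ n → ∣ seq z K ℚ.- seq z n ∣ ℚ.≤ δ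
    close-z n n≥ = proj₂ (cauchy z δ 0<δ) K n (ℕₚ.m≤n⊔m M N) (ℕₚ.m⊔n≤o⇒n≤o M N n≥)
    compare : (z ≤ y) ⊎ (x ≤ z)
    compare with ℚₚ.≤-total (seq z K) (seq x K ℚ.+ (δ ℚ.+ δ))
    ... | inj₁ z≤x+2δ = inj₁ (mk≤ λ ε 0<ε → K ℕ.⊔ L , λ n n≥ →
      let K≤n = ℕₚ.m⊔n≤o⇒m≤o K L n≥ in begin
      seq z n
        ≤⟨ ∣p-q∣≤r⇒q≤p+r (seq z K) (seq z n) (close-z n K≤n) ⟩
      seq z K ℚ.+ δ
        ≤⟨ ℚₚ.+-monoˡ-≤ δ z≤x+2δ ⟩
      (seq x K ℚ.+ (δ ℚ.+ δ)) ℚ.+ δ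
        ≤⟨ ℚₚ.+-monoˡ-≤ δ (ℚₚ.+-monoˡ-≤ (δ ℚ.+ δ)
             (∣p-q∣≤r⇒p≤q+r (seq x K) (seq x n) (close-x n K≤n))) ⟩
      ((seq x n ℚ.+ δ) ℚ.+ (δ ℚ.+ δ)) ℚ.+ δ
        ≡⟨ Q.solve 2 (λ a d → ((a Q.:+ d) Q.:+ (d Q.:+ d)) Q.:+ d Q.:=
             a Q.:+ ((d Q.:+ d) Q.:+ (d Q.:+ d))) refl (seq x n) δ ⟩
      seq x n ℚ.+ ((δ ℚ.+ δ) ℚ.+ (δ ℚ.+ δ))
        ≡⟨ cong (seq x n ℚ.+_) 4δ≡γ ⟩
      seq x n ℚ.+ γ
        ≤⟨ x+γ≤y n (ℕₚ.m⊔n≤o⇒n≤o K L n≥) ⟩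
      seq y n
        ≤⟨ p≤p+q (seq y n) (ℚₚ.<⇒≤ 0<ε) ⟩
      seq y n ℚ.+ ε ∎)
    ... | inj₂ x+2δ≤z = inj₂ (mk≤ λ ε 0<ε → K , λ n K≤n → begin
      seq x n
        ≤⟨ ∣p-q∣≤r⇒q≤p+r (seq x K) (seq x n) (close-x n K≤n) ⟩
      seq x K ℚ.+ δ
        ≡⟨ Q.solve 2 (λ a d → a Q.:+ d Q.:= (a Q.:+ (d Q.:+ d)) Q.:- d) refl (seq x K) δ ⟩
      (seq x K ℚ.+ (δ ℚ.+ δ)) ℚ.- δ
        ≤⟨ p≤q+r⇒p-q≤r _ δ (ℚₚ.≤-trans (ℚₚ.≤-trans x+2δ≤z
             (∣p-q∣≤r⇒p≤q+r (seq z K) (seq z n) (close-z n K≤n)))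
             (ℚₚ.≤-reflexive (ℚₚ.+-comm (seq z n) δ))) ⟩
      seq z n
        ≤⟨ p≤p+q (seq z n) (ℚₚ.<⇒≤ 0<ε) ⟩
      seq z n ℚ.+ ε ∎)

∃⊎∀ : ∀ {n} {P Q : Fin n → Set} → (∀ i → P i ⊎ Q i) → (∃[ i ] P i) ⊎ (∀ i → Q i)
∃⊎∀ {zero}  _ = inj₂ λ ()
∃⊎∀ {suc n} P⊎Q with P⊎Q zero | ∃⊎∀ (P⊎Q ∘ suc)
... | inj₁ p | _            = inj₁ (zero , p)
... | inj₂ _ | inj₁ (i , p) = inj₁ (suc i , p)
... | inj₂ q | inj₂ qs      = inj₂ λ where
  zero    → q
  (suc i) → qs i

-- Comparing reals is undecidable, so an index attaining at most the average cannot be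
-- found; the slack of 1 makes the search possible.
∃-below-average+1 : ∀ n a .{{_ : NonZero n}} (x : Fin n → ℝ) →
                    ∑ x ≤ fromℕ (n ℕ.* a) → ∃[ i ] x i ≤ fromℕ (suc a)
∃-below-average+1 n a x ∑x≤na = [ below , above ]′
  (∃⊎∀ (λ i → <-cotrans (fromℕ-mono-< 2a+1<2a+2) (fromℕ 2 * x i)))
  where
  open ≤-Reasoning
  -- Doubling turns the thresholds `a + 1/2` and `a + 1` into naturals. The lower one still exceeds
  -- the average, so not all terms can lie above it.
  2a+1<2a+2 : suc (2 ℕ.* a) ℕ.< 2 ℕ.* suc a
  2a+1<2a+2 = ℕₚ.≤-reflexive (sym (ℕₚ.*-suc 2 a))

  below : ∃[ i ] fromℕ 2 * x i ≤ fromℕ (2 ℕ.* suc a) → ∃[ i ] x i ≤ fromℕ (suc a)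
  below (i , 2x≤2a+2) = i , *-cancelˡ-≤ (fromℕ 2) {{0<fromℕ 2}}
    (≤-trans 2x≤2a+2 (≤-reflexive (fromℕ-* 2 (suc a))))

  above : (∀ i → fromℕ (suc (2 ℕ.* a)) ≤ fromℕ 2 * x i) → ∃[ i ] x i ≤ fromℕ (suc a)
  above 2a+1≤2x = contradiction (fromℕ-cancel-≤ (begin
    fromℕ (n ℕ.* suc (2 ℕ.* a))          ≈⟨ fromℕ-* n (suc (2 ℕ.* a)) ⟩
    fromℕ n * fromℕ (suc (2 ℕ.* a))      ≈⟨ ∑-const n (fromℕ (suc (2 ℕ.* a))) ⟨
    ∑ {n} (λ _ → fromℕ (suc (2 ℕ.* a)))  ≲⟨ ∑-mono-≤ 2a+1≤2x ⟩
    ∑ (λ i → fromℕ 2 * x i)              ≈⟨ ∑.*-distribˡ-sum (fromℕ 2) x ⟨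
    fromℕ 2 * ∑ x                        ≲⟨ *-monoˡ-≤ (fromℕ 2) (0≤fromℕ 2) ∑x≤na ⟩
    fromℕ 2 * fromℕ (n ℕ.* a)            ≈⟨ fromℕ-* 2 (n ℕ.* a) ⟨
    fromℕ (2 ℕ.* (n ℕ.* a))              ≡⟨ cong fromℕ
      (N.solve 2 (λ n a → N.con 2 N.:* (n N.:* a) N.:= n N.:* (N.con 2 N.:* a)) refl n a) ⟩
    fromℕ (n ℕ.* (2 ℕ.* a))              ∎))
    (ℕₚ.<⇒≱ (ℕₚ.*-monoʳ-< n (ℕₚ.n<1+n (2 ℕ.* a))))

-- Bounds on square roots.

m*m≤n*n⇒m≤n : ∀ {m n} → m ℕ.* m ℕ.≤ n ℕ.* n → m ℕ.≤ n
m*m≤n*n⇒m≤n m²≤n² = ℕₚ.≮⇒≥ λ n<m → ℕₚ.<⇒≱ (ℕₚ.*-mono-< n<m n<m) m²≤n²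

-- The terms of `√ k` are rounded down, so comparing squares bounds every single term and no
-- tolerance arises.
a*√k≤b : ∀ a b k → a ℕ.* a ℕ.* k ℕ.≤ b ℕ.* b → fromℕ a * √ k ≤ fromℕ b
a*√k≤b a b k a²k≤b² = ≤-pointwise λ n →
  subst (ℚ._≤ (ℤ.+ b ℚ./ 1)) (/-* a (r n) n) (/-mono-≤ (a ℕ.* r n) n b 0
    (subst (ℕ._≤ b ℕ.* suc n) (sym (ℕₚ.*-identityʳ (a ℕ.* r n))) (m*m≤n*n⇒m≤n (begin
    (a ℕ.* r n) ℕ.* (a ℕ.* r n)
      ≡⟨ N.solve 2 (λ a r → (a N.:* r) N.:* (a N.:* r) N.:= (a N.:* a) N.:* (r N.:* r))
           refl a (r n) ⟩
    (a ℕ.* a) ℕ.* (r n ℕ.* r n)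
      ≤⟨ ℕₚ.*-monoʳ-≤ (a ℕ.* a) (isqrt²≤ (k ℕ.* (suc n ℕ.* suc n))) ⟩
    (a ℕ.* a) ℕ.* (k ℕ.* (suc n ℕ.* suc n))
      ≡⟨ ℕₚ.*-assoc (a ℕ.* a) k (suc n ℕ.* suc n) ⟨
    a ℕ.* a ℕ.* k ℕ.* (suc n ℕ.* suc n)
      ≤⟨ ℕₚ.*-monoˡ-≤ (suc n ℕ.* suc n) a²k≤b² ⟩
    (b ℕ.* b) ℕ.* (suc n ℕ.* suc n)
      ≡⟨ N.solve 2 (λ b n → (b N.:* b) N.:* (n N.:* n) N.:= (b N.:* n) N.:* (b N.:* n))
           refl b (suc n) ⟩
    (b ℕ.* suc n) ℕ.* (b ℕ.* suc n) ∎))))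
  where
  open ℕₚ.≤-Reasoning
  r : ℕ → ℕ
  r n = isqrt (k ℕ.* (suc n ℕ.* suc n))

-- Instances with capped linear rewards.

-- Concavity of the minimum with `c` in additive form, which avoids the truncated subtraction of ℕ.
-- Removing 1 from both `t` and `c` reduces it to `t = 0`.
⊓-concave : ∀ t c → suc (suc t) ℕ.⊓ c ℕ.+ t ℕ.⊓ c ℕ.≤ suc t ℕ.⊓ c ℕ.+ suc t ℕ.⊓ c
⊓-concave zero    zero          = ℕ.z≤n
⊓-concave zero    (suc zero)    = ℕ.s≤s ℕ.z≤n
⊓-concave zero    (suc (suc c)) = ℕ.s≤s (ℕ.s≤s ℕ.z≤n)
⊓-concave (suc t) zero          = ℕ.z≤n
⊓-concave (suc t) (suc c)       = ℕ.s≤s (subst₂ ℕ._≤_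
  (sym (ℕₚ.+-suc (suc (suc t) ℕ.⊓ c) (t ℕ.⊓ c)))
  (sym (ℕₚ.+-suc (suc t ℕ.⊓ c) (suc t ℕ.⊓ c))) (ℕ.s≤s (⊓-concave t c)))

fromℕ-diff-≤ : ∀ {a b c} → a ℕ.+ c ℕ.≤ b ℕ.+ b →
               fromℕ a - fromℕ b ≤ fromℕ b - fromℕ c
fromℕ-diff-≤ {a} {b} {c} a+c≤2b = begin
  fromℕ a - fromℕ b                            ≈⟨ cancel (fromℕ a) (fromℕ b) (fromℕ c) ⟩
  (fromℕ a + fromℕ c) + (- fromℕ b - fromℕ c)  ≈⟨ +-cong (fromℕ-+ a c) R.refl ⟨
  fromℕ (a ℕ.+ c) + (- fromℕ b - fromℕ c)      ≲⟨ +-mono-≤ (fromℕ-mono-≤ a+c≤2b) (≤-reflexive R.refl) ⟩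
  fromℕ (b ℕ.+ b) + (- fromℕ b - fromℕ c)      ≈⟨ +-cong (fromℕ-+ b b) R.refl ⟩
  (fromℕ b + fromℕ b) + (- fromℕ b - fromℕ c)  ≈⟨ cancel′ (fromℕ b) (fromℕ c) ⟩
  fromℕ b - fromℕ c                            ∎
  where
  open ≤-Reasoning
  cancel : ∀ x y z → x - y ≈ (x + z) + (- y - z)
  cancel x y z = ≗⇒≈ λ n → Q.solve 3 (λ x y z →
    x Q.:- y Q.:= (x Q.:+ z) Q.:+ (Q.:- y Q.:- z)) refl (seq x n) (seq y n) (seq z n)
  cancel′ : ∀ y z → (y + y) + (- y - z) ≈ y - z
  cancel′ y z = ≗⇒≈ λ n → Q.solve 2 (λ y z →
    (y Q.:+ y) Q.:+ (Q.:- y Q.:- z) Q.:= y Q.:- z) refl (seq y n) (seq z n)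

-- Rewards are images of naturals, so equal capped counts give propositionally equal rewards and
-- hence equal histories. The coupling relies on this, as an algorithm may distinguish rewards that
-- are merely `_≈_`.
capped : ∀ {k} → (Fin k → ℕ) → Instance k
capped c = record
  { reward      = λ i t → fromℕ (t ℕ.⊓ c i)
  ; nonneg      = λ i t → 0≤fromℕ (t ℕ.⊓ c i)
  ; start       = λ i → R.refl
  ; mono        = λ i t → fromℕ-mono-≤ (ℕₚ.⊓-monoˡ-≤ (c i) (ℕₚ.n≤1+n t))
  ; diminishing = λ i t → fromℕ-diff-≤ {suc (suc t) ℕ.⊓ c i} {suc t ℕ.⊓ c i} {t ℕ.⊓ c i}
                            (⊓-concave t (c i))
  }

-- Expectation over runs of an algorithm.

-- `P n h` is an invariant of histories `h` with `n` pulls to go. Since every pull preserves it, `f`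
-- and `g` need comparing only at final histories that satisfy it.
𝔼-mono : ∀ {k} (A : Algorithm k) (I : Instance k) (P : ℕ → History k → Set)
         {f g : History k → ℝ} →
         (∀ {n h} i → P (suc n) h → P n (pull I i h)) →
         (∀ {h} → P 0 h → f h ≤ g h) →
         ∀ n {h} → P n h → 𝔼 A I n f h ≤ 𝔼 A I n g h
𝔼-mono A I P step f≤g zero    p = f≤g p
𝔼-mono A I P step f≤g (suc n) {h} p = ∑-mono-≤ λ i → *-monoˡ-≤ (Distribution.prob (A h) i)
  (Distribution.nonneg (A h) i) (𝔼-mono A I P step f≤g n (step i p))

∑-prob-* : ∀ {k} (D : Distribution k) x → ∑ (λ i → Distribution.prob D i * x) ≈ x
∑-prob-* D x = begin
  ∑ (λ i → Distribution.prob D i * x)  ≈⟨ ∑.*-distribʳ-sum x (Distribution.prob D) ⟨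
  ∑ (Distribution.prob D) * x          ≈⟨ *-cong (Distribution.normalised D) R.refl ⟩
  1ℝ * x                               ≈⟨ R.*-identityˡ x ⟩
  x                                    ∎
  where open ≈-Reasoning

module _ {k : ℕ} (A : Algorithm k) (I : Instance k) where

  𝔼-const : ∀ x n h → 𝔼 A I n (λ _ → x) h ≈ x
  𝔼-const x zero    h = R.refl
  𝔼-const x (suc n) h = R.trans
    (∑.sum-cong-≋ λ i → *-cong R.refl (𝔼-const x n (pull I i h)))
    (∑-prob-* (A h) x)

  𝔼-+ : ∀ f g n h → 𝔼 A I n (λ h → f h + g h) h ≈ 𝔼 A I n f h + 𝔼 A I n g h
  𝔼-+ f g zero    h = R.refl
  𝔼-+ f g (suc n) h = R.trans
    (∑.sum-cong-≋ λ i → R.trans (*-cong R.refl (𝔼-+ f g n (pull I i h)))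
      (R.distribˡ (Distribution.prob (A h) i) _ _))
    (∑.∑-distrib-+ (λ i → Distribution.prob (A h) i * 𝔼 A I n f (pull I i h))
                   (λ i → Distribution.prob (A h) i * 𝔼 A I n g (pull I i h)))

  𝔼-* : ∀ x f n h → 𝔼 A I n (λ h → x * f h) h ≈ x * 𝔼 A I n f h
  𝔼-* x f zero    h = R.refl
  𝔼-* x f (suc n) h = R.trans
    (∑.sum-cong-≋ λ i → R.trans (*-cong R.refl (𝔼-* x f n (pull I i h)))
      (S.solve 3 (λ p x e → p S.:* (x S.:* e) S.:= x S.:* (p S.:* e)) R.refl
        (Distribution.prob (A h) i) x (𝔼 A I n f (pull I i h))))
    (R.sym (∑.*-distribˡ-sum x (λ i → Distribution.prob (A h) i * 𝔼 A I n f (pull I i h))))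

  𝔼-∑ : ∀ {m} (f : Fin m → History k → ℝ) n h →
        𝔼 A I n (λ h → ∑ λ j → f j h) h ≈ ∑ λ j → 𝔼 A I n (f j) h
  𝔼-∑ {zero}  f n h = 𝔼-const 0ℝ n h
  𝔼-∑ {suc m} f n h = R.trans
    (𝔼-+ (f zero) (λ h → ∑ λ j → f (suc j) h) n h)
    (+-cong R.refl (𝔼-∑ (f ∘ suc) n h))

-- Counting pulls.

pulls-∷-≡ : ∀ {k} (i : Fin k) x h → pulls i ((i , x) ∷ h) ≡ suc (pulls i h)
pulls-∷-≡ i x h = cong length (Listₚ.filter-accept (i ≟_) refl)

pulls-∷-≢ : ∀ {k} {i j : Fin k} x h → j ≢ i → pulls j ((i , x) ∷ h) ≡ pulls j h
pulls-∷-≢ {i = i} {j} x h j≢i = cong length (Listₚ.filter-reject (j ≟_) j≢i)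

pulls≤pulls-∷ : ∀ {k} (j i : Fin k) x h → pulls j h ℕ.≤ pulls j ((i , x) ∷ h)
pulls≤pulls-∷ j i x h with j ≟ i
... | yes _ = ℕₚ.n≤1+n (pulls j h)
... | no  _ = ℕₚ.≤-refl

pulls≤length : ∀ {k} (i : Fin k) (h : History k) → pulls i h ℕ.≤ length h
pulls≤length i h = ℕₚ.≤-trans (Listₚ.length-filter (i ≟_) (map proj₁ h))
  (ℕₚ.≤-reflexive (Listₚ.length-map proj₁ h))

sum-increment : ∀ {n} (i : Fin n) (x y : Fin n → ℕ) → y i ≡ suc (x i) →
                (∀ {j} → j ≢ i → y j ≡ x j) → ∑ℕ.sum y ≡ suc (∑ℕ.sum x)
sum-increment zero    x y eq rest = cong₂ ℕ._+_ eq (∑ℕ.sum-cong-≗ λ j → rest {suc j} λ ())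
sum-increment (suc i) x y eq rest = trans
  (cong₂ ℕ._+_ (rest {zero} λ ())
    (sum-increment i (x ∘ suc) (y ∘ suc) eq λ j≢i → rest λ where refl → j≢i refl))
  (ℕₚ.+-suc (x zero) _)

sum-pulls : ∀ {k} (h : History k) → ∑ℕ.sum (λ j → pulls j h) ≡ length h
sum-pulls {k} []   = ∑ℕ.sum-replicate-zero k
sum-pulls ((i , x) ∷ h) = trans
  (sum-increment i (λ j → pulls j h) (λ j → pulls j ((i , x) ∷ h))
    (pulls-∷-≡ i x h) (pulls-∷-≢ x h))
  (cong suc (sum-pulls h))

-- Triangular numbers and the largest total reward.

-- This is `n (n + 1) / 2`; the recursion adds the largest reward that the latest pull can yield and
-- avoids dividing by 2.
triangle : ℕ → ℕ
triangle zero    = zero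
triangle (suc n) = suc n ℕ.+ triangle n

triangle-double : ∀ n → n ℕ.* n ℕ.+ n ≡ triangle n ℕ.+ triangle n
triangle-double zero    = refl
triangle-double (suc n) = trans
  (N.solve 1 (λ n → (N.con 1 N.:+ n) N.:* (N.con 1 N.:+ n) N.:+ (N.con 1 N.:+ n) N.:=
    N.con 2 N.:* (N.con 1 N.:+ n) N.:+ (n N.:* n N.:+ n)) refl n)
  (trans (cong (2 ℕ.* suc n ℕ.+_) (triangle-double n))
  (N.solve 2 (λ n t → N.con 2 N.:* (N.con 1 N.:+ n) N.:+ (t N.:+ t) N.:=
    ((N.con 1 N.:+ n) N.:+ t) N.:+ ((N.con 1 N.:+ n) N.:+ t)) refl n (triangle n)))

triangle-nonZero : ∀ n → .{{_ : NonZero n}} → NonZero (triangle n)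
triangle-nonZero (suc n) = _

m≤[1+m/n]*n : ∀ m n .{{_ : NonZero n}} → m ℕ.≤ suc (m ℕ./ n) ℕ.* n
m≤[1+m/n]*n m n = subst (ℕ._≤ suc (m ℕ./ n) ℕ.* n) (sym (m≡m%n+[m/n]*n m n))
  (ℕₚ.+-monoˡ-≤ (m ℕ./ n ℕ.* n) (ℕₚ.<⇒≤ (m%n<n m n)))

triangle≤square : ∀ n → triangle n ℕ.≤ n ℕ.* n
triangle≤square zero    = ℕ.z≤n
triangle≤square (suc n) = ℕₚ.+-monoʳ-≤ (suc n)
  (ℕₚ.≤-trans (triangle≤square n) (ℕₚ.*-monoʳ-≤ n (ℕₚ.n≤1+n n)))

sum-1+toℕ : ∀ n → ∑ℕ.sum {n} (suc ∘ toℕ) ≡ triangle n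
sum-1+toℕ zero    = refl
sum-1+toℕ (suc n) = cong suc (trans (∑ℕ.∑-distrib-+ {n} (const 1) (suc ∘ toℕ))
  (cong₂ ℕ._+_ (ones n) (sum-1+toℕ n)))
  where
  ones : ∀ n → ∑ℕ.sum {n} (const 1) ≡ n
  ones zero    = refl
  ones (suc n) = cong suc (ones n)

-- Arm `i` has at most `length h` earlier pulls and a cap can only lower its reward, so the new pull
-- yields at most `length h + 1`.
totalReward-pull≤triangle : ∀ {k} (c : Fin k → ℕ) i h →
  totalReward h ≤ fromℕ (triangle (length h)) →
  totalReward (pull (capped c) i h) ≤ fromℕ (triangle (suc (length h)))
totalReward-pull≤triangle c i h bound = ≤-trans
  (+-mono-≤ (fromℕ-mono-≤ (ℕₚ.≤-trans (ℕₚ.m⊓n≤m (suc (pulls i h)) (c i))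
                                      (ℕ.s≤s (pulls≤length i h)))) bound)
  (≤-reflexive (R.sym (fromℕ-+ (suc (length h)) (triangle (length h)))))

-- The crude bound for runs on which the two instances have been told apart. It starts from an
-- arbitrary history because this may happen midway.
𝔼-totalReward≤triangle : ∀ {k} (A : Algorithm k) (c : Fin k → ℕ) T n {h} →
  length h ℕ.+ n ≡ T → totalReward h ≤ fromℕ (triangle (length h)) →
  𝔼 A (capped c) n totalReward h ≤ fromℕ (triangle T)
𝔼-totalReward≤triangle A c T n {h} ∣h∣+n≡T bound = ≤-trans
  (𝔼-mono A (capped c)
    (λ n h → length h ℕ.+ n ≡ T × totalReward h ≤ fromℕ (triangle (length h)))
    (λ {n} {h} i (eq , b) →
      trans (sym (ℕₚ.+-suc (length h) n)) eq , totalReward-pull≤triangle c i h b)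
    (λ {h} (eq , b) → ≤-trans b (≤-reflexive (R.reflexive
      (cong (fromℕ ∘ triangle) (trans (sym (ℕₚ.+-identityʳ (length h))) eq)))))
    n (∣h∣+n≡T , bound))
  (≤-reflexive (𝔼-const A (capped c) (fromℕ (triangle T)) n h))

-- Coupling of the base and boosted instances.

boost : ∀ {k} → ℕ → ℕ → Fin k → Fin k → ℕ
boost s T j = updateAt (const s) j (const T)

module _ {k : ℕ} (A : Algorithm k) (s T : ℕ) (s≤T : s ℕ.≤ T) (j : Fin k) where

  private
    base boosted : Instance k
    base    = capped (const s)
    boosted = capped (boost s T j)

    -- Crossing the cap means at least s + 1 pulls of arm j, whose charge already covers
    -- s + 1 times the largest possible total reward.
    charge : History k → ℝ
    charge h = fromℕ (suc s ℕ.* (T ℕ.* s)) + fromℕ (triangle T) * fromℕ (pulls j h)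

    -- Arms other than `j` have the same cap in both instances, and for arm `j` neither cap acts on
    -- a pull numbered at most `s`, because `s ≤ T`. The remaining case is pull `s + 1` of arm `j`.
    -- Pull counts ignore rewards, so the claims about them hold for any `x`, in particular for the
    -- differing rewards at a crossing.
    agree-or-cross : ∀ i h → pulls j h ℕ.≤ s →
      (suc (pulls i h) ℕ.⊓ boost s T j i ≡ suc (pulls i h) ℕ.⊓ s ×
        (∀ x → pulls j ((i , x) ∷ h) ℕ.≤ s)) ⊎
      (∀ x → s ℕ.< pulls j ((i , x) ∷ h))
    agree-or-cross i h p≤s with i ≟ j
    ... | no i≢j = inj₁
      ( cong (suc (pulls i h) ℕ.⊓_) (updateAt-minimal i j (const s) i≢j)
      , λ x → subst (ℕ._≤ s) (sym (pulls-∷-≢ x h (≢-sym i≢j))) p≤s)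
    ... | yes refl with suc (pulls i h) ℕ.≤? s
    ...   | yes 1+p≤s = inj₁
      ( trans (cong (suc (pulls i h) ℕ.⊓_) (updateAt-updates i (const s)))
          (trans (ℕₚ.m≤n⇒m⊓n≡m (ℕₚ.≤-trans 1+p≤s s≤T)) (sym (ℕₚ.m≤n⇒m⊓n≡m 1+p≤s)))
      , λ x → subst (ℕ._≤ s) (sym (pulls-∷-≡ i x h)) 1+p≤s)
    ...   | no 1+p≰s = inj₂ λ x → subst (s ℕ.<_) (sym (pulls-∷-≡ i x h)) (ℕₚ.≰⇒> 1+p≰s)

    -- The count of arm `j` never decreases, so every final history still has at least `s + 1` pulls
    -- of it, and their charge alone pays the bound.
    crossed : ∀ n {h} → s ℕ.< pulls j h →
              fromℕ (suc s) * fromℕ (triangle T) ≤ 𝔼 A base n charge h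
    crossed n {h} s<p = ≤-trans
      (≤-reflexive (R.sym (𝔼-const A base (fromℕ (suc s) * fromℕ (triangle T)) n h)))
      (𝔼-mono A base (λ _ h → s ℕ.< pulls j h)
        (λ {_} {h} i s<p → ℕₚ.≤-trans s<p
          (pulls≤pulls-∷ j i (Instance.reward base i (suc (pulls i h))) h))
        (λ {h} → final h) n s<p)
      where
      open ≤-Reasoning
      final : ∀ h → s ℕ.< pulls j h → fromℕ (suc s) * fromℕ (triangle T) ≤ charge h
      final h s<p = begin
        fromℕ (suc s) * fromℕ (triangle T)
          ≈⟨ *-comm (fromℕ (suc s)) (fromℕ (triangle T)) ⟩
        fromℕ (triangle T) * fromℕ (suc s)
          ≲⟨ *-monoˡ-≤ (fromℕ (triangle T)) (0≤fromℕ (triangle T)) (fromℕ-mono-≤ s<p) ⟩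
        fromℕ (triangle T) * fromℕ (pulls j h)
          ≈⟨ R.+-identityˡ _ ⟨
        0ℝ + fromℕ (triangle T) * fromℕ (pulls j h)
          ≲⟨ +-mono-≤ (0≤fromℕ (suc s ℕ.* (T ℕ.* s))) (≤-reflexive R.refl) ⟩
        charge h ∎

    -- Induction on the remaining pulls, with both instances continuing from one shared history. The
    -- bound by `triangle` is kept for a later crossing, the bound by `length h * s` for a run that
    -- ends without one. Scaling by `s + 1` replaces the division in the charge per pull.
    coupled : ∀ n {h} → length h ℕ.+ n ≡ T →
      totalReward h ≤ fromℕ (triangle (length h)) →
      totalReward h ≤ fromℕ (length h ℕ.* s) → pulls j h ℕ.≤ s →
      𝔼 A boosted n (λ h → fromℕ (suc s) * totalReward h) h ≤ 𝔼 A base n charge h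
    coupled zero {h} ∣h∣≡T _ b p≤s = begin
      fromℕ (suc s) * totalReward h
        ≲⟨ *-monoˡ-≤ (fromℕ (suc s)) (0≤fromℕ (suc s)) b ⟩
      fromℕ (suc s) * fromℕ (length h ℕ.* s)
        ≈⟨ fromℕ-* (suc s) (length h ℕ.* s) ⟨
      fromℕ (suc s ℕ.* (length h ℕ.* s))
        ≡⟨ cong (λ l → fromℕ (suc s ℕ.* (l ℕ.* s)))
             (trans (sym (ℕₚ.+-identityʳ (length h))) ∣h∣≡T) ⟩
      fromℕ (suc s ℕ.* (T ℕ.* s))
        ≈⟨ R.+-identityʳ _ ⟨
      fromℕ (suc s ℕ.* (T ℕ.* s)) + 0ℝ
        ≈⟨ +-cong R.refl (R.zeroʳ (fromℕ (triangle T))) ⟨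
      fromℕ (suc s ℕ.* (T ℕ.* s)) + fromℕ (triangle T) * 0ℝ
        ≲⟨ +-mono-≤ (≤-reflexive R.refl)
             (*-monoˡ-≤ (fromℕ (triangle T)) (0≤fromℕ (triangle T)) (0≤fromℕ (pulls j h))) ⟩
      charge h ∎
      where open ≤-Reasoning
    -- The shared history gives both runs the same distribution of the next pull, so the two sums
    -- are compared arm by arm.
    coupled (suc n) {h} ∣h∣+1+n≡T b▵ b p≤s = ∑-mono-≤ λ i →
      *-monoˡ-≤ (Distribution.prob (A h) i) (Distribution.nonneg (A h) i)
        ([ agree i , cross i ]′ (agree-or-cross i h p≤s))
      where
      open ≤-Reasoning
      scaled : History k → ℝ
      scaled h = fromℕ (suc s) * totalReward h

      ∣h∣+n≡T : suc (length h) ℕ.+ n ≡ T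
      ∣h∣+n≡T = trans (sym (ℕₚ.+-suc (length h) n)) ∣h∣+1+n≡T

      agree : ∀ i → suc (pulls i h) ℕ.⊓ boost s T j i ≡ suc (pulls i h) ℕ.⊓ s ×
                    (∀ x → pulls j ((i , x) ∷ h) ℕ.≤ s) →
              𝔼 A boosted n scaled (pull boosted i h) ≤ 𝔼 A base n charge (pull base i h)
      -- Transport along equality of the rewards makes the two extended histories identical, and the
      -- induction hypothesis applies.
      agree i (same , uncrossed) = subst
        (λ r → 𝔼 A boosted n scaled ((i , fromℕ r) ∷ h) ≤ 𝔼 A base n charge (pull base i h))
        (sym same)
        (coupled n ∣h∣+n≡T (totalReward-pull≤triangle (const s) i h b▵)
          (≤-trans (+-mono-≤ (fromℕ-mono-≤ (ℕₚ.m⊓n≤n (suc (pulls i h)) s)) b)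
            (≤-reflexive (R.sym (fromℕ-+ s (length h ℕ.* s)))))
          (uncrossed (Instance.reward base i (suc (pulls i h)))))

      cross : ∀ i → (∀ x → s ℕ.< pulls j ((i , x) ∷ h)) →
              𝔼 A boosted n scaled (pull boosted i h) ≤ 𝔼 A base n charge (pull base i h)
      -- From here on the algorithm may behave differently in the two instances, so the sides are no
      -- longer coupled and are compared only through `(s + 1) M`.
      cross i s<p = begin
        𝔼 A boosted n scaled (pull boosted i h)
          ≈⟨ 𝔼-* A boosted (fromℕ (suc s)) totalReward n (pull boosted i h) ⟩
        fromℕ (suc s) * 𝔼 A boosted n totalReward (pull boosted i h)
          ≲⟨ *-monoˡ-≤ (fromℕ (suc s)) (0≤fromℕ (suc s))
               (𝔼-totalReward≤triangle A (boost s T j) T n ∣h∣+n≡T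
                 (totalReward-pull≤triangle (boost s T j) i h b▵)) ⟩
        fromℕ (suc s) * fromℕ (triangle T)
          ≲⟨ crossed n (s<p (Instance.reward base i (suc (pulls i h)))) ⟩
        𝔼 A base n charge (pull base i h) ∎

  -- The coupling from the empty history, its charge split by linearity of expectation.
  ALG-boosted≤ : fromℕ (suc s) * ALG A (capped (boost s T j)) T ≤
    fromℕ (suc s) * (fromℕ T * fromℕ s) +
    fromℕ (triangle T) * 𝔼 A (capped (const s)) T (λ h → fromℕ (pulls j h)) []
  ALG-boosted≤ = begin
    fromℕ (suc s) * ALG A boosted T
      ≈⟨ 𝔼-* A boosted (fromℕ (suc s)) totalReward T [] ⟨
    𝔼 A boosted T (λ h → fromℕ (suc s) * totalReward h) []
      ≲⟨ coupled T refl (≤-reflexive R.refl) (≤-reflexive R.refl) ℕ.z≤n ⟩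
    𝔼 A base T charge []
      ≈⟨ 𝔼-+ A base (const c) (λ h → m * p h) T [] ⟩
    𝔼 A base T (const c) [] + 𝔼 A base T (λ h → m * p h) []
      ≈⟨ +-cong (𝔼-const A base c T []) (𝔼-* A base m p T []) ⟩
    c + m * 𝔼 A base T p []
      ≈⟨ +-cong (R.trans (fromℕ-* (suc s) (T ℕ.* s)) (*-cong R.refl (fromℕ-* T s))) R.refl ⟩
    fromℕ (suc s) * (fromℕ T * fromℕ s) + m * 𝔼 A base T p [] ∎
    where
    open ≤-Reasoning
    c = fromℕ (suc s ℕ.* (T ℕ.* s))
    m = fromℕ (triangle T)
    p : History k → ℝ
    p h = fromℕ (pulls j h)

-- A rarely pulled arm, the optimum and the final estimate.

-- Sum and expectation are exchanged; every final history has length `T`, so its pull counts add up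
-- to `T`.
∑-𝔼-pulls≤ : ∀ {k} (A : Algorithm k) (I : Instance k) T →
             ∑ (λ j → 𝔼 A I T (λ h → fromℕ (pulls j h)) []) ≤ fromℕ T
∑-𝔼-pulls≤ A I T = begin
  ∑ (λ j → 𝔼 A I T (λ h → fromℕ (pulls j h)) [])
    ≈⟨ 𝔼-∑ A I (λ j h → fromℕ (pulls j h)) T [] ⟨
  𝔼 A I T (λ h → ∑ λ j → fromℕ (pulls j h)) []
    ≲⟨ 𝔼-mono A I (λ n h → length h ℕ.+ n ≡ T)
         (λ {n} {h} i → trans (sym (ℕₚ.+-suc (length h) n)))
         (λ {h} ∣h∣≡T → ≤-reflexive (R.trans (R.sym (fromℕ-∑ (λ j → pulls j h)))
           (R.reflexive (cong fromℕ (trans (sum-pulls h)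
             (trans (sym (ℕₚ.+-identityʳ (length h))) ∣h∣≡T))))))
         T refl ⟩
  𝔼 A I T (λ _ → fromℕ T) []
    ≈⟨ 𝔼-const A I (fromℕ T) T [] ⟩
  fromℕ T ∎
  where open ≤-Reasoning

-- Arm `j` alone earns `1 + 2 + ... + T`, as its cap `T` does not act on pulls up to number `T`.
triangle≤OPT-boosted : ∀ k .{{_ : NonZero k}} s T (j : Fin k) →
                       fromℕ (triangle T) ≤ OPT (capped (boost s T j)) T
triangle≤OPT-boosted k s T j = begin
  fromℕ (triangle T)
    ≡⟨ cong fromℕ (trans (sym (sum-1+toℕ T)) (∑ℕ.sum-cong-≗ {T} λ t → sym
         (trans (cong (suc (toℕ t) ℕ.⊓_) (updateAt-updates j (const s)))
           (ℕₚ.m≤n⇒m⊓n≡m (toℕ<n t))))) ⟩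
  fromℕ (∑ℕ.sum {T} λ t → suc (toℕ t) ℕ.⊓ boost s T j j)
    ≈⟨ fromℕ-∑ {T} (λ t → suc (toℕ t) ℕ.⊓ boost s T j j) ⟩
  ∑ {T} (λ t → fromℕ (suc (toℕ t) ℕ.⊓ boost s T j j))
    ≲⟨ ≤-maximum k (λ i → ∑ {T} λ t → fromℕ (suc (toℕ t) ℕ.⊓ boost s T j i)) j ⟩
  OPT (capped (boost s T j)) T ∎
  where open ≤-Reasoning

-- With t = T, σ = s + 1, m = M and u = 1/√κ, multiplying by t eliminates the division in
-- p ≤ (t+1)/κ: t·mp ≤ σκu·mp ≤ σu·m(t+1) ≤ σu·t(m+t), and t² + t + m = 3m.
coupling-bound⇒≤3mu : ∀ t {{0<t : 0ℝ < t}} σ {{0<σ : 0ℝ < σ}} κ u m s p a →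
  0ℝ ≤ t → 0ℝ ≤ σ → 0ℝ ≤ u → 0ℝ ≤ m → 0ℝ ≤ p →
  s ≤ t * u → t ≤ σ * κ * u → σ * a ≤ σ * (t * s) + m * p → κ * p ≤ t + 1ℝ →
  m ≤ t * t → t * t + t ≈ m + m → a ≤ fromℕ 3 * m * u
coupling-bound⇒≤3mu t σ κ u m s p a 0≤t 0≤σ 0≤u 0≤m 0≤p s≤tu t≤σκu σa≤ κp≤ m≤tt tt+t≈2m =
  *-cancelˡ-≤ t (*-cancelˡ-≤ σ (begin
    σ * (t * a)
      ≈⟨ swap σ t a ⟩
    t * (σ * a)
      ≲⟨ *-monoˡ-≤ t 0≤t σa≤ ⟩
    t * (σ * (t * s) + m * p)
      ≈⟨ S.solve 5 (λ t σ s m p → t S.:* (σ S.:* (t S.:* s) S.:+ m S.:* p) S.:=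
           (t S.:* (σ S.:* t)) S.:* s S.:+ t S.:* (m S.:* p)) R.refl t σ s m p ⟩
    (t * (σ * t)) * s + t * (m * p)
      ≲⟨ +-mono-≤ (*-monoˡ-≤ (t * (σ * t)) (0≤x*y 0≤t (0≤x*y 0≤σ 0≤t)) s≤tu)
                  (*-monoʳ-≤ (m * p) (0≤x*y 0≤m 0≤p) t≤σκu) ⟩
    (t * (σ * t)) * (t * u) + (σ * κ * u) * (m * p)
      ≈⟨ S.solve 6 (λ t σ u κ m p →
           (t S.:* (σ S.:* t)) S.:* (t S.:* u) S.:+ (σ S.:* κ S.:* u) S.:* (m S.:* p) S.:=
           (t S.:* (σ S.:* t)) S.:* (t S.:* u) S.:+ (σ S.:* u S.:* m) S.:* (κ S.:* p))
           R.refl t σ u κ m p ⟩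
    (t * (σ * t)) * (t * u) + (σ * u * m) * (κ * p)
      ≲⟨ +-mono-≤ (≤-reflexive R.refl)
                  (*-monoˡ-≤ (σ * u * m) (0≤x*y (0≤x*y 0≤σ 0≤u) 0≤m) κp≤) ⟩
    (t * (σ * t)) * (t * u) + (σ * u * m) * (t + 1ℝ)
      ≈⟨ S.solve 4 (λ t σ u m →
           (t S.:* (σ S.:* t)) S.:* (t S.:* u) S.:+ (σ S.:* u S.:* m) S.:* (t S.:+ S.con 1) S.:=
           (σ S.:* u) S.:* (t S.:* (t S.:* t) S.:+ m S.:* t S.:+ m)) R.refl t σ u m ⟩
    (σ * u) * (t * (t * t) + m * t + m)
      ≲⟨ *-monoˡ-≤ (σ * u) (0≤x*y 0≤σ 0≤u) (+-mono-≤ (≤-reflexive R.refl) m≤tt) ⟩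
    (σ * u) * (t * (t * t) + m * t + t * t)
      ≈⟨ S.solve 4 (λ t σ u m →
           (σ S.:* u) S.:* (t S.:* (t S.:* t) S.:+ m S.:* t S.:+ t S.:* t) S.:=
           (σ S.:* u S.:* t) S.:* ((t S.:* t S.:+ t) S.:+ m)) R.refl t σ u m ⟩
    (σ * u * t) * ((t * t + t) + m)
      ≈⟨ *-cong R.refl (+-cong tt+t≈2m R.refl) ⟩
    (σ * u * t) * ((m + m) + m)
      ≈⟨ S.solve 4 (λ t σ u m → (σ S.:* u S.:* t) S.:* ((m S.:+ m) S.:+ m) S.:=
           σ S.:* (t S.:* (((S.con 1 S.:+ (S.con 1 S.:+ S.con 1)) S.:* m) S.:* u))) R.refl t σ u m ⟩
    σ * (t * ((1ℝ + (1ℝ + 1ℝ)) * m * u))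
      ≈⟨ *-cong R.refl (*-cong R.refl (*-cong (*-cong 3≈1+1+1 R.refl) R.refl)) ⟨
    σ * (t * (fromℕ 3 * m * u)) ∎))
  where
  open ≤-Reasoning
  swap : ∀ x y z → x * (y * z) ≈ y * (x * z)
  swap = S.solve 3 (λ x y z → x S.:* (y S.:* z) S.:= y S.:* (x S.:* z)) R.refl
  3≈1+1+1 : fromℕ 3 ≈ 1ℝ + (1ℝ + 1ℝ)
  3≈1+1+1 = R.trans (fromℕ-+ 1 2) (+-cong R.refl (fromℕ-+ 1 1))
  0≤x*y : ∀ {x y} → 0ℝ ≤ x → 0ℝ ≤ y → 0ℝ ≤ x * y
  0≤x*y {x} 0≤x 0≤y = ≤-trans (≤-reflexive (R.sym (R.zeroʳ x))) (*-monoˡ-≤ x 0≤x 0≤y)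

corollary3p2p1 : ∀ (k T : ℕ) → .{{_ : NonZero k}} → .{{_ : NonZero T}} →
    (A : Algorithm k) →
    ∃[ I ] (0ℝ < OPT I T) × (ALG A I T ≤ fromℕ 3 * OPT I T / √ k)
corollary3p2p1 k T A = boosted , <-≤-trans (0<fromℕ (triangle T) {{triangle-nonZero T}}) m≤OPT ,
  (begin
    ALG A boosted T
      ≲⟨ coupling-bound⇒≤3mu (fromℕ T) {{0<fromℕ T}} (fromℕ (suc s)) {{0<fromℕ (suc s)}} (fromℕ k) u
           (fromℕ (triangle T)) (fromℕ s) (P j) (ALG A boosted T)
           (0≤fromℕ T) (0≤fromℕ (suc s)) 0≤u (0≤fromℕ (triangle T)) 0≤Pj
           s≤Tu T≤σku (ALG-boosted≤ A s T s≤T j) kPj≤T+1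
           (≤-trans (fromℕ-mono-≤ (triangle≤square T)) (≤-reflexive (fromℕ-* T T)))
           TT+T≈2m ⟩
    fromℕ 3 * fromℕ (triangle T) * u
      ≲⟨ *-monoʳ-≤ u 0≤u (*-monoˡ-≤ (fromℕ 3) (0≤fromℕ 3) m≤OPT) ⟩
    fromℕ 3 * OPT boosted T / √ k ∎)
  where
  open ≤-Reasoning

  -- This is the floor of `T / √k`, computed in ℕ. The two roundings are controlled by `s² k ≤ T²`
  -- and `T² ≤ (s + 1)² k`.
  s : ℕ
  s = isqrt (T ℕ.* T ℕ./ k)

  u : ℝ
  u = (√ k) ⁻¹

  0≤u : 0ℝ ≤ u
  0≤u = ⁻¹-nonneg (√ k)

  s²k≤T² : s ℕ.* s ℕ.* k ℕ.≤ T ℕ.* T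
  s²k≤T² = ℕₚ.≤-trans (ℕₚ.*-monoˡ-≤ k (isqrt²≤ (T ℕ.* T ℕ./ k))) (m/n*n≤m (T ℕ.* T) k)

  T²≤[1+s]²k : T ℕ.* T ℕ.≤ suc s ℕ.* suc s ℕ.* k
  T²≤[1+s]²k = ℕₚ.≤-trans (m≤[1+m/n]*n (T ℕ.* T) k)
    (ℕₚ.*-monoˡ-≤ k (<[1+isqrt]² (T ℕ.* T ℕ./ k)))

  s≤T : s ℕ.≤ T
  s≤T = m*m≤n*n⇒m≤n (ℕₚ.≤-trans (ℕₚ.m≤m*n (s ℕ.* s) k) s²k≤T²)

  s≤Tu : fromℕ s ≤ fromℕ T * u
  s≤Tu = x*y≤z⇒x≤z/y (fromℕ s) (√ k) (fromℕ T) (a*√k≤b s T k s²k≤T²)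

  -- This is `T ≤ (s + 1) √k` with `√k` written as `k / √k`. Cleared of the division and squared, it
  -- is `T² ≤ (s + 1)² k` multiplied by `k`.
  T≤σku : fromℕ T ≤ fromℕ (suc s) * fromℕ k * u
  T≤σku = x*y≤z⇒x≤z/y (fromℕ T) (√ k) (fromℕ (suc s) * fromℕ k) (≤-trans
    (a*√k≤b T (suc s ℕ.* k) k (subst (T ℕ.* T ℕ.* k ℕ.≤_)
      (N.solve 2 (λ a k → a N.:* a N.:* k N.:* k N.:= (a N.:* k) N.:* (a N.:* k)) refl (suc s) k)
      (ℕₚ.*-monoˡ-≤ k T²≤[1+s]²k)))
    (≤-reflexive (fromℕ-* (suc s) k)))

  P : Fin k → ℝ
  P j = 𝔼 A (capped (const s)) T (λ h → fromℕ (pulls j h)) []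

  -- Averaging is applied to `k * P j`, whose mean is at most the natural number `T`; the slack of 1
  -- then costs only `1/k` of a pull.
  rare : ∃[ j ] fromℕ k * P j ≤ fromℕ (suc T)
  rare = ∃-below-average+1 k T (λ j → fromℕ k * P j) (begin
    ∑ (λ j → fromℕ k * P j)  ≈⟨ ∑.*-distribˡ-sum (fromℕ k) P ⟨
    fromℕ k * ∑ P            ≲⟨ *-monoˡ-≤ (fromℕ k) (0≤fromℕ k) (∑-𝔼-pulls≤ A (capped (const s)) T) ⟩
    fromℕ k * fromℕ T        ≈⟨ fromℕ-* k T ⟨
    fromℕ (k ℕ.* T)          ∎)

  j : Fin k
  j = proj₁ rare

  boosted : Instance k
  boosted = capped (boost s T j)

  m≤OPT : fromℕ (triangle T) ≤ OPT boosted T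
  m≤OPT = triangle≤OPT-boosted k s T j

  kPj≤T+1 : fromℕ k * P j ≤ fromℕ T + 1ℝ
  kPj≤T+1 = ≤-trans (proj₂ rare) (≤-reflexive (R.trans
    (R.reflexive (cong fromℕ (ℕₚ.+-comm 1 T))) (fromℕ-+ T 1)))

  0≤Pj : 0ℝ ≤ P j
  0≤Pj = ≤-trans (≤-reflexive (R.sym (𝔼-const A (capped (const s)) 0ℝ T [])))
    (𝔼-mono A (capped (const s)) (λ _ _ → ⊤) (λ _ _ → tt)
      (λ {h} _ → 0≤fromℕ (pulls j h)) T tt)

  TT+T≈2m : fromℕ T * fromℕ T + fromℕ T ≈ fromℕ (triangle T) + fromℕ (triangle T)
  TT+T≈2m = R.trans
    (R.sym (R.trans (fromℕ-+ (T ℕ.* T) T) (+-cong (fromℕ-* T T) R.refl)))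
    (R.trans (R.reflexive (cong fromℕ (triangle-double T))) (fromℕ-+ (triangle T) (triangle T)))
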